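{- The code $\mathcal{C}_0=\{3456,123,145,256,45,56,1,2,3,\emptyset\}\subseteq 2^{[6]}$ (where e.g. $3456$ denotes $\{3,4,5,6\}$) is minimally non-convex and has no local obstructions of the first or second kind.
   Context: A code is a subset $\mathcal{C}\subseteq 2^{[n]}$. For $\sigma\subseteq[n]$, $\mathrm{Tk}_{\mathcal{C}}(\sigma)=\{c\in\mathcal{C}\mid\sigma\subseteq c\}$; a trunk in $\mathcal{C}$ is a subset that is empty or of this form. A morphism $f:\mathcal{C}\to\mathcal{D}$ is a function such that preimages of trunks in $\mathcal{D}$ are trunks in $\mathcal{C}$; an isomorphism is a morphism whose inverse function is a morphism. Given $U_1,\dots,U_n\subseteq X$, $\mathrm{code}(\mathcal{U},X)=\{\sigma\subseteq[n]\mid \bigcap_{i\in\sigma}U_i\setminus\bigcup_{j\notin\sigma}U_j\neq\emptyset\}$, the empty intersection being $X$. A code is convex if it equals $\mathrm{code}(\mathcal{U},X)$ for some open convex $X\subseteq\mathbb{R}^d$ and convex open $U_i\subseteq X$. A code $\mathcal{C}$ is minimally non-convex if it is not convex, every trunk properly contained in $\mathcal{C}$ is convex, and every image $f(\mathcal{C})$ under a morphism that is not isomorphic to $\mathcal{C}$ is convex. $\Delta(\mathcal{C})$ denotes the simplicial complex consisting of all subsets of codewords of $\mathcal{C}$. $\mathcal{C}$ has a local obstruction (of the first kind) at $\sigma\in\Delta(\mathcal{C})\setminus\mathcal{C}$ if $\mathrm{link}_{\Delta(\mathcal{C})}(\sigma)$ is not contractible, and a local obstruction of the second kind at $\sigma\in\Delta(\mathcal{C})\setminus\mathcal{C}$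 if $\mathrm{link}_{\Delta(\mathcal{C})}(\sigma)$ is not collapsible. -}

module Defs where

open import Algebra.Bundles using (CommutativeRing)
open import Data.Fin using (Fin; #_)
open import Data.Fin.Subset as Sub using (Subset; ⁅_⁆; ⋃; _∩_; _∪_; Nonempty)
open import Data.List using (List; []; _∷_; map)
import Data.List.Membership.Propositional as List
open import Data.Nat using (ℕ)
open import Data.Product using (Σ; Σ-syntax; ∃; ∃-syntax; _×_; _,_)
open import Data.Refinement using (Refinement; value; _,_)
open import Data.Irrelevant using ([_])
open import Data.Sum using (_⊎_)
open import Data.Vec.Functional using (Vector)
open import Function.Bundles using (_↔_; Inverse)
open import Level using (0ℓ; suc)
open import Relation.Binary using (Rel; IsStrictTotalOrder)
open import Relation.Binary.Construct.Closure.ReflexiveTransitive using (Star)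
import Relation.Binary.Construct.StrictToNonStrict as StrictToNonStrict
open import Relation.Binary.PropositionalEquality using (_≡_)
open import Relation.Nullary using (¬_)
open import Relation.Unary using (Pred; _∈_; _∉_; _⊂_; _≐_; _∖_; Empty)
  renaming (_⊆_ to _⊆ₚ_)

-- The standard library has no real numbers, so ℝ is taken axiomatically: it is
-- the Dedekind-complete ordered field, unique up to isomorphism.  The order is
-- trichotomous and suprema exist for arbitrary predicates, as classically; with
-- excluded middle, decidable Dedekind cuts of ℚ form an instance.

record CompleteOrderedField : Set (suc 0ℓ) where
  infix 4 _<_
  field
    commutativeRing : CommutativeRing 0ℓ 0ℓ
  open CommutativeRing commutativeRing public
  field
    _<_                : Rel Carrier 0ℓ
    isStrictTotalOrder : IsStrictTotalOrder _≈_ _<_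
    0≉1                : ¬ 0# ≈ 1#
    inverse            : ∀ x → ¬ x ≈ 0# → ∃[ y ] x * y ≈ 1#
    +-mono-<           : ∀ {x y} z → x < y → x + z < y + z
    *-pos              : ∀ {x y} → 0# < x → 0# < y → 0# < x * y

  open StrictToNonStrict _≈_ _<_ public using (_≤_)

  UpperBound : Pred Carrier 0ℓ → Pred Carrier 0ℓ
  UpperBound P b = ∀ x → x ∈ P → x ≤ b

  field
    supremum : ∀ (P : Pred Carrier 0ℓ) → ∃ P → ∃ (UpperBound P) →
               ∃[ s ] s ∈ UpperBound P × (∀ b → b ∈ UpperBound P → s ≤ b)

------------------------------------------------------------------------
-- Codes and morphisms

Code : ℕ → Set (suc 0ℓ)
Code n = Pred (Subset n) 0ℓ

-- The membership proof is irrelevant, so two elements of Codeword C are equal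
-- as soon as the underlying subsets are.
Codeword : ∀ {n} → Code n → Set
Codeword {n} C = Refinement (Subset n) C

Tk : ∀ {n} → Code n → Subset n → Code n
Tk C σ c = c ∈ C × σ Sub.⊆ c

IsTrunk : ∀ {n} → Code n → Code n → Set
IsTrunk C T = Empty T ⊎ ∃[ σ ] T ≐ Tk C σ

module _ {m n} {C : Code m} {D : Code n} (f : Codeword C → Codeword D) where

  preimage : Code n → Code m
  preimage T c = Σ[ c∈C ∈ c ∈ C ] value (f (c , [ c∈C ])) ∈ T

  image : Code n
  image d = ∃[ c ] Σ[ c∈C ∈ c ∈ C ] value (f (c , [ c∈C ])) ≡ d

  IsMorphism : Set (suc 0ℓ)
  IsMorphism = ∀ T → IsTrunk D T → IsTrunk C (preimage T)

Isomorphic : ∀ {m n} → Code m → Code n → Set (suc 0ℓ)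
Isomorphic C D = Σ[ f ∈ Codeword C ↔ Codeword D ]
  IsMorphism {C = C} {D} (Inverse.to f) × IsMorphism {C = D} {C} (Inverse.from f)

------------------------------------------------------------------------
-- Simplicial complexes, given by their sets of faces (including ∅)

Complex : ℕ → Set (suc 0ℓ)
Complex n = Pred (Subset n) 0ℓ

Δ : ∀ {n} → Code n → Complex n
Δ C σ = ∃[ c ] c ∈ C × σ Sub.⊆ c

link : ∀ {n} → Complex n → Subset n → Complex n
link K σ τ = Sub.Empty (σ ∩ τ) × (σ ∪ τ) ∈ K

IsFacet : ∀ {n} → Complex n → Subset n → Set
IsFacet K σ = σ ∈ K × (∀ ρ → ρ ∈ K → σ Sub.⊆ ρ → ρ ≡ σ)

-- τ is a free face of K: σ is the only facet containing it, and τ ≠ σ.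
FreeIn : ∀ {n} → Complex n → Subset n → Subset n → Set
FreeIn K τ σ = Nonempty τ × τ Sub.⊂ σ × IsFacet K σ ×
               (∀ ρ → IsFacet K ρ → τ Sub.⊆ ρ → ρ ≡ σ)

_↘_ : ∀ {n} → Complex n → Complex n → Set
K ↘ L = ∃[ τ ] ∃[ σ ] FreeIn K τ σ × L ≐ K ∖ (λ γ → τ Sub.⊆ γ × γ Sub.⊆ σ)

vertex : ∀ {n} → Fin n → Complex n
vertex v γ = γ Sub.⊆ ⁅ v ⁆

Collapsible : ∀ {n} → Complex n → Set (suc 0ℓ)
Collapsible K = ∃[ v ] ∃[ L ] Star _↘_ K L × L ≐ vertex v

------------------------------------------------------------------------
-- Geometry of ℝᵈ

module _ (ℝ : CompleteOrderedField) where
  open CompleteOrderedField ℝ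
  open import Algebra.Definitions.RawMonoid +-rawMonoid using (sum)

  Point : ℕ → Set
  Point d = Vector Carrier d

  -- Basic neighbourhoods in ℝ and in the product topology of ℝᵈ.
  Close : Carrier → Carrier → Carrier → Set
  Close ε x y = x - ε < y × y < x + ε

  Near : ∀ {d} → Carrier → Point d → Point d → Set
  Near ε p q = ∀ i → Close ε (p i) (q i)

  IsOpen : ∀ {d} → Pred (Point d) 0ℓ → Set
  IsOpen U = ∀ p → p ∈ U → ∃[ ε ] 0# < ε × (∀ q → Near ε p q → q ∈ U)

  IsConvex : ∀ {d} → Pred (Point d) 0ℓ → Set
  IsConvex U = ∀ p q → p ∈ U → q ∈ U → ∀ t → 0# ≤ t → t ≤ 1# →
               (λ i → (1# - t) * p i + t * q i) ∈ U

  -- The conjunct p ∈ X accounts for the empty intersection being X; for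
  -- nonempty σ it is redundant when every U i is contained in X.
  code : ∀ {d n} → (Fin n → Pred (Point d) 0ℓ) → Pred (Point d) 0ℓ → Code n
  code U X σ = ∃[ p ] p ∈ X × (∀ i → i Sub.∈ σ → p ∈ U i)
                            × (∀ j → j Sub.∉ σ → p ∉ U j)

  ConvexCode : ∀ {n} → Code n → Set (suc 0ℓ)
  ConvexCode {n} C =
    ∃[ d ] Σ[ X ∈ Pred (Point d) 0ℓ ] Σ[ U ∈ (Fin n → Pred (Point d) 0ℓ) ]
      IsOpen X × IsConvex X ×
      (∀ i → IsOpen (U i) × IsConvex (U i) × U i ⊆ₚ X) ×
      C ≐ code U X

  MinimallyNonConvex : ∀ {n} → Code n → Set (suc 0ℓ)
  MinimallyNonConvex {n} C =
    ¬ ConvexCode C ×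
    (∀ T → IsTrunk C T → T ⊂ C → ConvexCode T) ×
    (∀ {m} (D : Code m) (f : Codeword C → Codeword D) →
       IsMorphism {C = C} {D} f →
       ¬ Isomorphic (image {C = C} {D} f) C → ConvexCode (image {C = C} {D} f))

  -- Geometric realization, in barycentric coordinates.
  ∣_∣ : ∀ {n} → Complex n → Pred (Point n) 0ℓ
  ∣ K ∣ p = (∀ v → 0# ≤ p v) × sum p ≈ 1# ×
            ∃[ σ ] σ ∈ K × (∀ v → v Sub.∉ σ → p v ≈ 0#)

  UnitInterval : Set
  UnitInterval = Σ[ t ∈ Carrier ] 0# ≤ t × t ≤ 1#

  -- Contractibility of S with the subspace topology: a continuous homotopy
  -- [0,1] × S → S from the identity to a constant map.
  Contractible : ∀ {d} → Pred (Point d) 0ℓ → Set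
  Contractible S =
    Σ[ H ∈ (UnitInterval → ∃ S → ∃ S) ]
      IsContinuous H ×
      (∀ t x → coord t ≈ 0# → ∀ i → pt (H t x) i ≈ pt x i) ×
      (∃[ x₀ ] ∀ t x → coord t ≈ 1# → ∀ i → pt (H t x) i ≈ pt {S = S} x₀ i)
    where
    coord : UnitInterval → Carrier
    coord (t , _) = t

    pt : ∀ {d} {S : Pred (Point d) 0ℓ} → ∃ S → Point d
    pt (p , _) = p

    IsContinuous : (UnitInterval → ∃ S → ∃ S) → Set
    IsContinuous H = ∀ t x ε → 0# < ε → ∃[ δ ] 0# < δ ×
      (∀ t′ x′ → Close δ (coord t) (coord t′) → Near δ (pt x) (pt x′) →
       Near ε (pt (H t x)) (pt (H t′ x′)))

  LocalObstruction₁ : ∀ {n} → Code n → Subset n → Set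
  LocalObstruction₁ C σ = σ ∈ Δ C ∖ C × ¬ Contractible ∣ link (Δ C) σ ∣

LocalObstruction₂ : ∀ {n} → Code n → Subset n → Set (suc 0ℓ)
LocalObstruction₂ C σ = σ ∈ Δ C ∖ C × ¬ Collapsible (link (Δ C) σ)

------------------------------------------------------------------------

C₀ : Code 6
C₀ = List._∈ map word
  ( (𝟑 ∷ 𝟒 ∷ 𝟓 ∷ 𝟔 ∷ []) ∷ (𝟏 ∷ 𝟐 ∷ 𝟑 ∷ []) ∷ (𝟏 ∷ 𝟒 ∷ 𝟓 ∷ []) ∷ (𝟐 ∷ 𝟓 ∷ 𝟔 ∷ [])
  ∷ (𝟒 ∷ 𝟓 ∷ []) ∷ (𝟓 ∷ 𝟔 ∷ []) ∷ (𝟏 ∷ []) ∷ (𝟐 ∷ []) ∷ (𝟑 ∷ []) ∷ [] ∷ [])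
  where
  word : List (Fin 6) → Subset 6
  word vs = ⋃ (map ⁅_⁆ vs)

  𝟏 𝟐 𝟑 𝟒 𝟓 𝟔 : Fin 6
  𝟏 = # 0
  𝟐 = # 1
  𝟑 = # 2
  𝟒 = # 3
  𝟓 = # 4
  𝟔 = # 5

{-# OPTIONS --safe #-}

-- Non-convexity: U₅ = U₄ ∪ U₆ contains a segment from U₁ ∩ U₄ to U₂ ∩ U₆, which by connectedness has a point of
-- U₄ ∩ U₆ ⊆ U₃.  But U₁, U₂, U₃ meet pairwise only in U₁ ∩ U₂ ∩ U₃, which is nonempty and disjoint from U₅, and then
-- no segment from U₁ to U₂ outside U₁ ∩ U₂ ∩ U₃ can meet U₃.
--
-- Minimality: a morphism f from C₀ is determined by the trunks f⁻¹(Tk {j}).  If each Tk {i} is among them, f is an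
-- isomorphism onto its image.  If Tk {i} is missing, f(C₀) is realized by any convex open X labelled by codewords of C₀
-- in such a way that every trunk other than Tk {i} labels a convex open set; for each i there is such an X.
--
-- Obstructions: the links in question reduce to a point by deleting dominated vertices, which is both a sequence of
-- elementary collapses and a homotopy moving the mass of each deleted vertex to the vertex dominating it.
module Submission where

open import Defs
open import Algebra.Solver.Ring.AlmostCommutativeRing using (fromCommutativeRing; _-Raw-AlmostCommutative⟶_)
import Algebra.Solver.Ring as RingSolver
open import Data.Bool using (Bool; true; false; if_then_else_)
import Data.Bool.Properties as Bool
open import Data.Empty using (⊥; ⊥-elim; ⊥-elim-irr)
open import Data.Fin using (Fin; zero; suc; #_)
import Data.Fin.Properties as Fin
open import Data.Fin.Subset as Sub using (Subset; ⁅_⁆; inside; outside)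
open import Data.Fin.Subset.Properties as Sub
  using (_∈?_; _⊆?_; _⊂?_; anySubset?; nonempty?; ⊆-antisym; ⊆-trans; x∈⁅x⁆; x∈⁅y⁆⇒x≡y)
open import Data.Integer as ℤ using (ℤ; +_; -[1+_]; _⊖_)
import Data.Integer.Properties as ℤ
open import Data.Irrelevant as Irrelevant using (Irrelevant; [_])
open import Data.List as List using (List; []; _∷_)
import Data.List.Membership.DecPropositional as DecMembership
import Data.List.Membership.Propositional as Mem
open import Data.List.Relation.Unary.All as All using (All; []; _∷_)
open import Data.List.Relation.Unary.Any as Any using (Any)
open import Data.Maybe as Maybe using ()
open import Data.Nat as ℕ using (ℕ; zero; suc)
import Data.Nat.Properties as ℕ
open import Data.Product using (Σ; Σ-syntax; ∃; ∃-syntax; _×_; _,_; proj₁; proj₂)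
open import Data.Refinement using (Refinement; value; _,_)
open import Data.Sum as Sum using (_⊎_; inj₁; inj₂)
open import Data.Vec as Vec using (Vec; []; _∷_; lookup; there)
import Data.Vec.Functional as Functional
import Data.Vec.Properties as Vec
open import Function using (_∘_; id; case_of_)
open import Function.Bundles using (_↔_; mk↔ₛ′)
open import Level using (0ℓ)
open import Relation.Binary using (IsStrictTotalOrder; tri<; tri≈; tri>)
open import Relation.Binary.Construct.Closure.ReflexiveTransitive as Star using (_◅_)
import Relation.Binary.PropositionalEquality as ≡
open ≡ using (_≡_; _≢_)
open import Relation.Nullary using (¬_; Dec; yes; no; does)
open import Relation.Nullary.Decidable using
  ( map′; ¬?; _×-dec_; _⊎-dec_; _→-dec_; toWitness; decidable-stable; dec-true; dec-false; dec⇒maybe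
  ; recompute; ¬¬-excluded-middle)
open import Relation.Unary using (Pred; Decidable; _∩_; _∖_; _≐_; Empty; _⊂_) renaming (_⊆_ to _⊆ₚ_)

-- Membership in the unknown sets `U i` is not decidable, and this splits the proof into two styles.
-- Non-convexity is a refutation, so each point may be given its codeword under double negation.
-- Convexity needs actual data: the realizations label a point by the signs of its coordinates,
-- which are decidable, so that the correctness of a labelling becomes a statement about finitely
-- many subsets, settled by evaluation. This reduction loses nothing: a sum is positive only if one
-- of its terms is, and every sign vector that passes this test for all defining inequalities comes
-- with an explicit integer point. The homotopies move the mass min(t, x v) rather than t times x v.
-- They are thus built from sums, negations and positive parts, and their continuity involves no
-- product of two varying quantities.

-- Finite subsets and decidability

∈-tabulate⁺ : ∀ {n} {P : Pred (Fin n) 0ℓ} (P? : ∀ j → Dec (P j)) {j} → P j → j Sub.∈ Vec.tabulate (does ∘ P?)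
∈-tabulate⁺ P? {j} p = Vec.lookup⇒[]= j _ (≡.trans (Vec.lookup∘tabulate (does ∘ P?) j) (dec-true (P? j) p))

∈-tabulate⁻ : ∀ {n} {P : Pred (Fin n) 0ℓ} (P? : ∀ j → Dec (P j)) {j} → j Sub.∈ Vec.tabulate (does ∘ P?) → P j
∈-tabulate⁻ P? {j} j∈ = decidable-stable (P? j) λ ¬p →
  case ≡.trans (≡.sym (dec-false (P? j) ¬p)) (≡.trans (≡.sym (Vec.lookup∘tabulate (does ∘ P?) j)) (Vec.[]=⇒lookup j∈))
  of λ ()

subset-ext : ∀ {n} {s t : Subset n} → (∀ j → j Sub.∈ s → j Sub.∈ t) → (∀ j → j Sub.∉ s → j Sub.∉ t) → s ≡ t
subset-ext {s = s} s⊆t s∁⊆t∁ =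
  ⊆-antisym (s⊆t _) (λ {j} j∈t → decidable-stable (j ∈? s) (λ j∉s → s∁⊆t∁ j j∉s j∈t))

⁅⁆⊆ : ∀ {n} {i : Fin n} {c} → i Sub.∈ c → ⁅ i ⁆ Sub.⊆ c
⁅⁆⊆ {i = i} {c} i∈c k∈ = ≡.subst (Sub._∈ c) (≡.sym (x∈⁅y⁆⇒x≡y i k∈)) i∈c

x∉p-x : ∀ {n} (p : Subset n) x → x Sub.∉ p Sub.- x
x∉p-x (_ ∷ p) zero    ()
x∉p-x (_ ∷ p) (suc x) (there x∈) = x∉p-x p x x∈

-- Double-negation shift, which holds because the index set is finite.
¬¬-∀ : ∀ {k} {P : Fin k → Set} → (∀ i → ¬ ¬ P i) → ¬ ¬ (∀ i → P i)
¬¬-∀ {zero}  f k = k (λ ())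
¬¬-∀ {suc n} f k = f zero λ p → ¬¬-∀ (f ∘ suc) λ ps → k λ { zero → p ; (suc i) → ps i }

_≟ₛ_ : ∀ {n} (s t : Subset n) → Dec (s ≡ t)
_≟ₛ_ = Vec.≡-dec Bool._≟_

allSubset? : ∀ {n} {P : Pred (Subset n) 0ℓ} → Decidable P → Dec (∀ s → P s)
allSubset? P? = map′ (λ ¬∃ s → decidable-stable (P? s) (λ ¬p → ¬∃ (s , ¬p)))
                     (λ all (s , ¬p) → ¬p (all s))
                     (¬? (anySubset? (¬? ∘ P?)))

-- The code C₀ and its trunks

words : List (Subset 6)
words = proj₁ enumeration
  where
  -- The list of codewords is recovered from the definition of `C₀` by unification.
  enumeration : ∃[ cs ] C₀ ≡ (Mem._∈ cs)
  enumeration = _ , ≡.refl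

C₀? : Decidable C₀
C₀? c = DecMembership._∈?_ _≟ₛ_ c words

-- Inclusion of the trunk `Tk C₀ σ` in the trunk `Tk C₀ τ`.
Finer : Subset 6 → Subset 6 → Set
Finer σ τ = ∀ c → C₀ c → σ Sub.⊆ c → τ Sub.⊆ c

finer? : ∀ σ τ → Dec (Finer σ τ)
finer? σ τ = map′ (λ all c c∈ → All.lookup all c∈) (λ f → All.tabulate (λ {c} → f c))
  (All.all? (λ c → (σ ⊆? c) →-dec (τ ⊆? c)) words)

𝟏 𝟐 𝟑 𝟒 𝟓 𝟔 : Fin 6
𝟏 = # 0
𝟐 = # 1
𝟑 = # 2
𝟒 = # 3
𝟓 = # 4
𝟔 = # 5

-- Apart from the presence of 123, 145 and 256, this is all that the non-convexity argument draws
-- from `C₀`.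
Relations : Subset 6 → Set
Relations c =
  (𝟓 Sub.∈ c → 𝟒 Sub.∈ c ⊎ 𝟔 Sub.∈ c) × (𝟒 Sub.∈ c → 𝟔 Sub.∈ c → 𝟑 Sub.∈ c) ×
  (𝟏 Sub.∈ c → 𝟑 Sub.∈ c → 𝟐 Sub.∈ c) × (𝟐 Sub.∈ c → 𝟑 Sub.∈ c → 𝟏 Sub.∈ c) ×
  (𝟏 Sub.∈ c → 𝟑 Sub.∈ c → 𝟓 Sub.∉ c)

abstract
  relations : ∀ c → C₀ c → Relations c
  relations c = All.lookup (toWitness {a? = All.all? relations? words} _)
    where
    relations? : ∀ c → Dec (Relations c)
    relations? c =
      ((𝟓 ∈? c) →-dec ((𝟒 ∈? c) ⊎-dec (𝟔 ∈? c))) ×-dec ((𝟒 ∈? c) →-dec ((𝟔 ∈? c) →-dec (𝟑 ∈? c))) ×-dec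
      ((𝟏 ∈? c) →-dec ((𝟑 ∈? c) →-dec (𝟐 ∈? c))) ×-dec ((𝟐 ∈? c) →-dec ((𝟑 ∈? c) →-dec (𝟏 ∈? c))) ×-dec
      ((𝟏 ∈? c) →-dec ((𝟑 ∈? c) →-dec ¬? (𝟓 ∈? c)))

  123∈C₀ : C₀ (inside ∷ inside ∷ inside ∷ outside ∷ outside ∷ outside ∷ [])
  123∈C₀ = toWitness {a? = C₀? _} _

  145∈C₀ : C₀ (inside ∷ outside ∷ outside ∷ inside ∷ inside ∷ outside ∷ [])
  145∈C₀ = toWitness {a? = C₀? _} _

  256∈C₀ : C₀ (outside ∷ inside ∷ outside ∷ outside ∷ inside ∷ inside ∷ [])
  256∈C₀ = toWitness {a? = C₀? _} _

-- Membership in the target of a morphism is only known irrelevantly; trunks of C₀ are decidable, which makes it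
-- relevant again.
recover : ∀ {Q c} → IsTrunk C₀ Q → C₀ c → Irrelevant (Q c) → Q c
recover (inj₁ empty)             c∈ [ q ] = ⊥-elim-irr (empty _ q)
recover (inj₂ (σ , Q⊆Tk , Tk⊆Q)) c∈ [ q ] = Tk⊆Q (c∈ , recompute (σ ⊆? _) (proj₂ (Q⊆Tk q)))

-- The trunk is Tk C₀ ⁅ i ⁆.
Hits : ∀ {Q} → IsTrunk C₀ Q → Fin 6 → Set
Hits (inj₁ _)       i = ⊥
Hits (inj₂ (σ , _)) i = Finer σ ⁅ i ⁆ × Finer ⁅ i ⁆ σ

hits? : ∀ {Q} (trunk : IsTrunk C₀ Q) i → Dec (Hits trunk i)
hits? (inj₁ _)       i = no id
hits? (inj₂ (σ , _)) i = finer? σ ⁅ i ⁆ ×-dec finer? ⁅ i ⁆ σ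

hits⇒∈ : ∀ {Q} (trunk : IsTrunk C₀ Q) {i} → Hits trunk i → ∀ {c} → Q c → i Sub.∈ c
hits⇒∈ (inj₂ (σ , Q⊆Tk , Tk⊆Q)) {i} (σ⊑i , i⊑σ) q = let c∈ , σ⊆c = Q⊆Tk q in σ⊑i _ c∈ σ⊆c (x∈⁅x⁆ i)

∈⇒hits : ∀ {Q} (trunk : IsTrunk C₀ Q) {i} → Hits trunk i → ∀ {c} → C₀ c → i Sub.∈ c → Q c
∈⇒hits (inj₂ (σ , Q⊆Tk , Tk⊆Q)) (σ⊑i , i⊑σ) c∈ i∈c = Tk⊆Q (c∈ , i⊑σ _ c∈ (⁅⁆⊆ i∈c))

-- Charts

-- A clause with sign s and support S holds at p ∈ ℝᵏ if 0 < Σ_{i ∈ S} ± p i (with sign + if s is true); then some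
-- literal ± p i with i ∈ S is positive, which is all that the set of positive coordinates of p has to satisfy.
record Clause (k : ℕ) : Set where
  constructor _,_
  field
    sign    : Bool
    support : Subset k

Satisfies : ∀ {k} → Subset k → Clause k → Set
Satisfies b (s , S) = ∃[ i ] i Sub.∈ S × lookup b i ≡ s

Model : ∀ {k} → List (Clause k) → Subset k → Set
Model cs b = All (Satisfies b) cs

model? : ∀ {k} (cs : List (Clause k)) → Decidable (Model cs)
model? cs b = All.all? (λ { (s , S) → Fin.any? (λ i → (i ∈? S) ×-dec (lookup b i Bool.≟ s)) }) cs

-- X is cut out of ℝᵏ by the clauses, word labels a point according to its set of positive coordinates, and
-- point b is meant to be a point of X whose set of positive coordinates is b.
record Chart : Set where
  field
    dim     : ℕ
    clauses : List (Clause dim)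
    word    : Subset dim → Subset 6
    point   : Subset dim → Vec ℤ dim

pattern ● = inside
pattern ○ = outside

-- With coordinates a, b, c, y subject to a + b + c + y < 0, U₁ = {b, c > 0}, U₂ = {a, c > 0}, U₃ = {a, b > 0},
-- U₄ = {b, y > 0}, U₅ = {y > 0} and U₆ = {a, y > 0} realize every trunk but one of Tk {4}, Tk {5}, Tk {6}, depending
-- on the label u of the points with y > 0 ≥ a, b.
sphereChart : Subset 6 → Chart
sphereChart u = record
  { dim     = 4
  ; clauses = (false , ● ∷ ● ∷ ● ∷ ● ∷ []) ∷ []
  ; word    = word
  -- One coordinate -4 outweighs the other three, which are at most 1 each.
  ; point   = Vec.map (λ x → if x then + 1 else -[1+ 3 ])
  }
  where
  word : Subset 4 → Subset 6
  word (● ∷ ● ∷ ● ∷ ○ ∷ []) = ● ∷ ● ∷ ● ∷ ○ ∷ ○ ∷ ○ ∷ []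
  word (○ ∷ ● ∷ ● ∷ ● ∷ []) = ● ∷ ○ ∷ ○ ∷ ● ∷ ● ∷ ○ ∷ []
  word (● ∷ ○ ∷ ● ∷ ● ∷ []) = ○ ∷ ● ∷ ○ ∷ ○ ∷ ● ∷ ● ∷ []
  word (● ∷ ● ∷ ○ ∷ ● ∷ []) = ○ ∷ ○ ∷ ● ∷ ● ∷ ● ∷ ● ∷ []
  word (○ ∷ ● ∷ ● ∷ ○ ∷ []) = ● ∷ ○ ∷ ○ ∷ ○ ∷ ○ ∷ ○ ∷ []
  word (● ∷ ○ ∷ ● ∷ ○ ∷ []) = ○ ∷ ● ∷ ○ ∷ ○ ∷ ○ ∷ ○ ∷ []
  word (● ∷ ● ∷ ○ ∷ ○ ∷ []) = ○ ∷ ○ ∷ ● ∷ ○ ∷ ○ ∷ ○ ∷ []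
  word (○ ∷ ● ∷ ○ ∷ ● ∷ []) = ○ ∷ ○ ∷ ○ ∷ ● ∷ ● ∷ ○ ∷ []
  word (● ∷ ○ ∷ ○ ∷ ● ∷ []) = ○ ∷ ○ ∷ ○ ∷ ○ ∷ ● ∷ ● ∷ []
  word (○ ∷ ○ ∷ _ ∷ ● ∷ []) = u
  word _                    = ○ ∷ ○ ∷ ○ ∷ ○ ∷ ○ ∷ ○ ∷ []

-- The coordinates l, r, y, f, g imitate the signs of 1 - x, 1 + x, y, - 1 - x - y, x - y - 1 in the plane, with
-- U₁ = {f > 0}, U₂ = {g > 0}, U₃ = {l, r > 0}, U₄ = {l, y > 0}, U₅ = {y > 0}, U₆ = {r, y > 0}.  This is right where
-- y > 0; elsewhere the label is given by v, which has to misrepresent one of U₁, U₂, U₃.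
stripChart : (Subset 4 → Subset 6) → Chart
stripChart v = record
  { dim     = 5
  ; clauses = (true  , ● ∷ ● ∷ ○ ∷ ○ ∷ ○ ∷ [])
            ∷ (false , ○ ∷ ● ∷ ● ∷ ● ∷ ○ ∷ [])
            ∷ (false , ● ∷ ○ ∷ ● ∷ ○ ∷ ● ∷ []) ∷ []
  ; word    = word
  ; point   = point
  }
  where
  word : Subset 5 → Subset 6
  word (_ ∷ _ ∷ ● ∷ ● ∷ _ ∷ []) = ● ∷ ○ ∷ ○ ∷ ● ∷ ● ∷ ○ ∷ []
  word (_ ∷ _ ∷ ● ∷ ○ ∷ ● ∷ []) = ○ ∷ ● ∷ ○ ∷ ○ ∷ ● ∷ ● ∷ []
  word (● ∷ ● ∷ ● ∷ ○ ∷ ○ ∷ []) = ○ ∷ ○ ∷ ● ∷ ● ∷ ● ∷ ● ∷ []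
  word (● ∷ ○ ∷ ● ∷ ○ ∷ ○ ∷ []) = ○ ∷ ○ ∷ ○ ∷ ● ∷ ● ∷ ○ ∷ []
  word (○ ∷ _ ∷ ● ∷ ○ ∷ ○ ∷ []) = ○ ∷ ○ ∷ ○ ∷ ○ ∷ ● ∷ ● ∷ []
  word (l ∷ r ∷ ○ ∷ f ∷ g ∷ []) = v (l ∷ r ∷ f ∷ g ∷ [])

  far : Bool → ℤ
  far x = if x then + 1 else -[1+ 99 ]

  point : Subset 5 → Vec ℤ 5
  -- The values meet the three clauses: l + r is at least 9 - 8; a value -100 of y, f or g outweighs
  -- the rest of its sum, which is at most 9 + 1; and a lone nonpositive r or l still gives -8 + 1 +
  -- 1 < 0.
  point (l ∷ r ∷ y ∷ f ∷ g ∷ []) = side l r ∷ side r l ∷ far y ∷ far f ∷ far g ∷ []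
    where
    side : Bool → Bool → ℤ
    side ● ● = + 1
    side ● ○ = + 9
    side ○ _ = -[1+ 7 ]

-- Labelling by the signs of f, g and of l, r alone would produce words such as 13. To avoid them,
-- two of U₁, U₂, U₃ keep their defining signs and the third is altered: it is added on the whole
-- intersection of these two, removed where exactly one of them holds, and kept elsewhere. The
-- subscript names the altered set.
below₁ below₂ below₃ : Subset 4 → Subset 6
below₁ (● ∷ ● ∷ _ ∷ ● ∷ []) = ● ∷ ● ∷ ● ∷ ○ ∷ ○ ∷ ○ ∷ []
below₁ (● ∷ ● ∷ _ ∷ ○ ∷ []) = ○ ∷ ○ ∷ ● ∷ ○ ∷ ○ ∷ ○ ∷ []
below₁ (_ ∷ _ ∷ _ ∷ ● ∷ []) = ○ ∷ ● ∷ ○ ∷ ○ ∷ ○ ∷ ○ ∷ []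
below₁ (_ ∷ _ ∷ ● ∷ ○ ∷ []) = ● ∷ ○ ∷ ○ ∷ ○ ∷ ○ ∷ ○ ∷ []
below₁ (_ ∷ _ ∷ ○ ∷ ○ ∷ []) = ○ ∷ ○ ∷ ○ ∷ ○ ∷ ○ ∷ ○ ∷ []
below₂ (● ∷ ● ∷ ● ∷ _ ∷ []) = ● ∷ ● ∷ ● ∷ ○ ∷ ○ ∷ ○ ∷ []
below₂ (● ∷ ● ∷ ○ ∷ _ ∷ []) = ○ ∷ ○ ∷ ● ∷ ○ ∷ ○ ∷ ○ ∷ []
below₂ (_ ∷ _ ∷ ● ∷ _ ∷ []) = ● ∷ ○ ∷ ○ ∷ ○ ∷ ○ ∷ ○ ∷ []
below₂ (_ ∷ _ ∷ ○ ∷ ● ∷ []) = ○ ∷ ● ∷ ○ ∷ ○ ∷ ○ ∷ ○ ∷ []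
below₂ (_ ∷ _ ∷ ○ ∷ ○ ∷ []) = ○ ∷ ○ ∷ ○ ∷ ○ ∷ ○ ∷ ○ ∷ []
below₃ (_ ∷ _ ∷ ● ∷ ● ∷ []) = ● ∷ ● ∷ ● ∷ ○ ∷ ○ ∷ ○ ∷ []
below₃ (_ ∷ _ ∷ ● ∷ ○ ∷ []) = ● ∷ ○ ∷ ○ ∷ ○ ∷ ○ ∷ ○ ∷ []
below₃ (_ ∷ _ ∷ ○ ∷ ● ∷ []) = ○ ∷ ● ∷ ○ ∷ ○ ∷ ○ ∷ ○ ∷ []
below₃ (● ∷ ● ∷ ○ ∷ ○ ∷ []) = ○ ∷ ○ ∷ ● ∷ ○ ∷ ○ ∷ ○ ∷ []
below₃ (_ ∷ _ ∷ ○ ∷ ○ ∷ []) = ○ ∷ ○ ∷ ○ ∷ ○ ∷ ○ ∷ ○ ∷ []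

chart : Fin 6 → Chart
chart zero                               = stripChart below₁
chart (suc zero)                         = stripChart below₂
chart (suc (suc zero))                   = stripChart below₃
chart (suc (suc (suc zero)))             = sphereChart (○ ∷ ○ ∷ ○ ∷ ● ∷ ● ∷ ○ ∷ [])
chart (suc (suc (suc (suc zero))))       = sphereChart (○ ∷ ○ ∷ ○ ∷ ○ ∷ ○ ∷ ○ ∷ [])
chart (suc (suc (suc (suc (suc zero))))) = sphereChart (○ ∷ ○ ∷ ○ ∷ ○ ∷ ● ∷ ● ∷ [])

module _ (χ : Chart) where
  open Chart χ

  formℤ : Clause dim → Vec ℤ dim → ℤ
  formℤ (s , S) z = Functional.foldr ℤ._+_ (+ 0)
    (λ j → if lookup S j then (if s then lookup z j else ℤ.- lookup z j) else + 0)

  WordsInC₀ : Set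
  WordsInC₀ = ∀ b → Model clauses b → C₀ (word b)

  Onto : Set
  Onto = ∀ c → C₀ c → ∃[ b ] Model clauses b × word b ≡ c

  -- The points whose label contains σ are either none, or those of X in the open orthant where the
  -- coordinates in S are positive. Either way they form a convex open set.
  CutOut : Subset 6 → Set
  CutOut σ = (∀ b → Model clauses b → ¬ σ Sub.⊆ word b) ⊎
    ∃[ S ] (∀ b → Model clauses b → (S Sub.⊆ b → σ Sub.⊆ word b) × (σ Sub.⊆ word b → S Sub.⊆ b))

  Realized : Set
  Realized = ∀ b → Model clauses b →
    (∀ j → (j Sub.∈ b → + 0 ℤ.< lookup (point b) j) × (j Sub.∉ b → ¬ + 0 ℤ.< lookup (point b) j)) ×
    All (λ c → + 0 ℤ.< formℤ c (point b)) clauses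

  wordsInC₀? : Dec WordsInC₀
  wordsInC₀? = allSubset? (λ b → model? clauses b →-dec C₀? (word b))

  onto? : Dec Onto
  onto? = map′ (λ all c c∈ → All.lookup all c∈) (λ f → All.tabulate (λ {c} → f c))
    (All.all? (λ c → anySubset? (λ b → model? clauses b ×-dec (word b ≟ₛ c))) words)

  cutOut? : Decidable CutOut
  cutOut? σ = allSubset? (λ b → model? clauses b →-dec ¬? (σ ⊆? word b)) ⊎-dec
    anySubset? (λ S → allSubset? (λ b → model? clauses b →-dec
      (((S ⊆? b) →-dec (σ ⊆? word b)) ×-dec ((σ ⊆? word b) →-dec (S ⊆? b)))))

  realized? : Dec Realized
  realized? = allSubset? (λ b → model? clauses b →-dec
    (Fin.all? (λ j → ((j ∈? b) →-dec (+ 0 ℤ.<? lookup (point b) j)) ×-dec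
                     (¬? (j ∈? b) →-dec ¬? (+ 0 ℤ.<? lookup (point b) j))) ×-dec
     All.all? (λ c → + 0 ℤ.<? formℤ c (point b)) clauses))

abstract
  chart-wordsInC₀ : ∀ i → WordsInC₀ (chart i)
  chart-wordsInC₀ = toWitness {a? = Fin.all? (λ i → wordsInC₀? (chart i))} _

  chart-onto : ∀ i → Onto (chart i)
  chart-onto = toWitness {a? = Fin.all? (λ i → onto? (chart i))} _

  chart-realized : ∀ i → Realized (chart i)
  chart-realized = toWitness {a? = Fin.all? (λ i → realized? (chart i))} _

  -- All trunks are covered, not only those of single indices, because the preimage of `Tk D ⁅ j ⁆`
  -- under a morphism can be any trunk.
  chart-cutOut : ∀ i σ → (Finer σ ⁅ i ⁆ × Finer ⁅ i ⁆ σ) ⊎ CutOut (chart i) σ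
  chart-cutOut = toWitness {a? = Fin.all? (λ i → allSubset? (λ σ →
    (finer? σ ⁅ i ⁆ ×-dec finer? ⁅ i ⁆ σ) ⊎-dec cutOut? (chart i) σ))} _

  finer-⊥ : ∀ i → ¬ Finer Sub.⊥ ⁅ i ⁆
  finer-⊥ = toWitness {a? = Fin.all? (λ i → ¬? (finer? Sub.⊥ ⁅ i ⁆))} _

  -- If `Tk C₀ ⁅ i ⁆` is not contained in `Tk C₀ σ`, it is none of the trunks inside `Tk C₀ σ`, so
  -- `chart i` represents all of these by convex open sets.
  trunk-avoids : ∀ σ → Finer Sub.⊥ σ ⊎ ∃[ i ] ¬ Finer ⁅ i ⁆ σ
  trunk-avoids = toWitness {a? = allSubset? (λ σ → finer? Sub.⊥ σ ⊎-dec Fin.any? (λ i → ¬? (finer? ⁅ i ⁆ σ)))} _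

-- Collapses of links

Δ? : Decidable (Δ C₀)
Δ? σ = map′ Mem.find (λ (_ , c∈ , σ⊆c) → Mem.lose c∈ σ⊆c) (Any.any? (σ ⊆?_) words)

link? : ∀ σ → Decidable (link (Δ C₀) σ)
link? σ τ = ¬? (nonempty? (σ Sub.∩ τ)) ×-dec Δ? (σ Sub.∪ τ)

deletion : ∀ {n} → Complex n → Fin n → Complex n
deletion K v τ = K τ × v Sub.∉ τ

-- Both faces serve the homotopy from `v` to `a`: it runs inside the first and ends in the second.
-- As `K` is an arbitrary predicate, closure under subsets cannot supply the second.
Dominates : ∀ {n} → Complex n → Fin n → Fin n → Set
Dominates K a v = v ≢ a × (∀ σ → K σ → v Sub.∈ σ → K (σ Sub.∪ ⁅ a ⁆) × K ((σ Sub.∪ ⁅ a ⁆) Sub.- v))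

-- In a pair (v , a), a is a vertex dominating the vertex v to be deleted.
StrongCollapse : ∀ {n} → List (Fin n × Fin n) → Fin n → Complex n → Set
StrongCollapse [] a K = K ⁅ a ⁆ × (∀ σ → K σ → σ Sub.⊆ ⁅ a ⁆)
StrongCollapse ((v , a) ∷ ps) r K = Dominates K a v × StrongCollapse ps r (deletion K v)

strongCollapse? : ∀ {n} ps (r : Fin n) {K : Complex n} → Decidable K → Dec (StrongCollapse ps r K)
strongCollapse? [] a K? = K? ⁅ a ⁆ ×-dec allSubset? (λ σ → K? σ →-dec (σ ⊆? ⁅ a ⁆))
strongCollapse? ((v , a) ∷ ps) r K? =
  (¬? (v Fin.≟ a) ×-dec
   allSubset? (λ σ → K? σ →-dec ((v ∈? σ) →-dec (K? (σ Sub.∪ ⁅ a ⁆) ×-dec K? ((σ Sub.∪ ⁅ a ⁆) Sub.- v))))) ×-dec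
  strongCollapse? ps r (λ τ → K? τ ×-dec ¬? (v ∈? τ))

removal : ∀ {n} → Complex n → Subset n → Subset n → Complex n
removal K τ σ = K ∖ (λ γ → τ Sub.⊆ γ × γ Sub.⊆ σ)

-- Freeness is expressed by σ being the greatest face above τ. This is decided by one pass over the
-- subsets, without a test for facets; `free` recovers the official notion.
Collapse : ∀ {n} → List (Subset n × Subset n) → Fin n → Complex n → Set
Collapse [] a K = ∀ γ → (K γ → γ Sub.⊆ ⁅ a ⁆) × (γ Sub.⊆ ⁅ a ⁆ → K γ)
Collapse ((τ , σ) ∷ ps) r K =
  (Sub.Nonempty τ × τ Sub.⊂ σ × K σ × (∀ ρ → K ρ → τ Sub.⊆ ρ → ρ Sub.⊆ σ)) ×
  Collapse ps r (removal K τ σ)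

collapse? : ∀ {n} ps (r : Fin n) {K : Complex n} → Decidable K → Dec (Collapse ps r K)
collapse? [] a K? = allSubset? (λ σ → (K? σ →-dec (σ ⊆? ⁅ a ⁆)) ×-dec ((σ ⊆? ⁅ a ⁆) →-dec K? σ))
collapse? ((τ , σ) ∷ ps) r K? =
  (nonempty? τ ×-dec (τ ⊂? σ) ×-dec K? σ ×-dec allSubset? (λ ρ → K? ρ →-dec ((τ ⊆? ρ) →-dec (ρ ⊆? σ)))) ×-dec
  collapse? ps r (λ γ → K? γ ×-dec ¬? ((τ ⊆? γ) ×-dec (γ ⊆? σ)))

-- Since `inside` precedes `outside` in each coordinate, every set is listed before its proper
-- subsets. The order of the collapses in `elementary` comes from this.
allSubsets : ∀ n → List (Subset n)
allSubsets zero    = [] ∷ []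
allSubsets (suc n) = List.map (inside ∷_) (allSubsets n) List.++ List.map (outside ∷_) (allSubsets n)

-- Deleting v amounts to removing the pairs (τ , τ ∪ a) with v ∈ τ ∌ a, larger faces τ first.
elementary : List (Fin 6 × Fin 6) → ∀ {K : Complex 6} → Decidable K → List (Subset 6 × Subset 6)
elementary [] K? = []
elementary ((v , a) ∷ ps) K? =
  List.map (λ τ → τ , τ Sub.∪ ⁅ a ⁆) (List.filter (λ τ → (v ∈? τ) ×-dec ¬? (a ∈? τ) ×-dec K? τ) (allSubsets 6))
  List.++ elementary ps (λ τ → K? τ ×-dec ¬? (v ∈? τ))

-- The link of 5 has facets 346, 14 and 26; all other links in question are cones.
schedules : List (List (Fin 6 × Fin 6) × Fin 6)
schedules = ((𝟏 , 𝟒) ∷ (𝟐 , 𝟔) ∷ (𝟑 , 𝟒) ∷ (𝟔 , 𝟒) ∷ [] , 𝟒)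
          -- These are the schedules for cones with apex `a`. A `v` that is not a vertex of the link
          -- is dominated vacuously and contributes no elementary pair, so one list per apex fits
          -- all links.
          ∷ List.map (λ a → List.map (_, a) (List.filter (λ v → ¬? (v Fin.≟ a)) (List.allFin 6)) , a) (List.allFin 6)

Good : Subset 6 → List (Fin 6 × Fin 6) × Fin 6 → Set
Good σ (ps , r) = StrongCollapse ps r (link (Δ C₀) σ) × Collapse (elementary ps (link? σ)) r (link (Δ C₀) σ)

good? : ∀ σ → Decidable (Good σ)
good? σ (ps , r) = strongCollapse? ps r (link? σ) ×-dec collapse? (elementary ps (link? σ)) r (link? σ)

abstract
  link-good : ∀ σ → Δ C₀ σ → ¬ C₀ σ → Any (Good σ) schedules
  link-good = toWitness {a? = allSubset? (λ σ → Δ? σ →-dec (¬? (C₀? σ) →-dec Any.any? (good? σ) schedules))} _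

free : ∀ {n} {K : Complex n} {τ σ} → Sub.Nonempty τ → τ Sub.⊂ σ → K σ →
       (∀ ρ → K ρ → τ Sub.⊆ ρ → ρ Sub.⊆ σ) → FreeIn K τ σ
free ne τ⊂σ σ∈K below = ne , τ⊂σ ,
  (σ∈K , λ ρ ρ∈K σ⊆ρ → ⊆-antisym (below ρ ρ∈K (⊆-trans (proj₁ τ⊂σ) σ⊆ρ)) σ⊆ρ) ,
  λ ρ (ρ∈K , maximal) τ⊆ρ → ≡.sym (maximal _ σ∈K (below ρ ρ∈K τ⊆ρ))

collapse⇒collapsible : ∀ {n} ps (r : Fin n) {K} → Collapse ps r K → Collapsible K
collapse⇒collapsible []             r {K} K≐r = r , K , Star.ε , (λ {γ} → proj₁ (K≐r γ)) , (λ {γ} → proj₂ (K≐r γ))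
collapse⇒collapsible ((τ , σ) ∷ ps) r ((ne , τ⊂σ , σ∈K , below) , p) =
  let v , L , star , L≐v = collapse⇒collapsible ps r p
  in v , L , (τ , σ , free ne τ⊂σ σ∈K below , id , id) ◅ star , L≐v

no-obstruction₂ : ¬ ∃ (LocalObstruction₂ C₀)
no-obstruction₂ (σ , (σ∈Δ , σ∉C₀) , ¬collapsible) =
  let (ps , r) , _ , p = Any.satisfied (link-good σ σ∈Δ σ∉C₀)
  in ¬collapsible (collapse⇒collapsible (elementary ps (link? σ)) r p)

module _ (ℝ : CompleteOrderedField) where

  open CompleteOrderedField ℝ hiding (zero)
  open import Algebra.Definitions.RawMonoid +-rawMonoid using (sum)
  open import Algebra.Properties.CommutativeMonoid.Sum +-commutativeMonoid
    using (∑-distrib-+; sum-cong-≋; sum-replicate-zero)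
  open import Algebra.Properties.Ring ring using (-0#≈0#; -‿distribˡ-*; -‿distribʳ-*; -‿involutive; -‿+-comm)
  open import Algebra.Properties.Semiring.Mult.TCOptimised semiring
    using (×-homo-+; ×1-homo-*; 1+×) renaming (_×_ to _×ₙ_)
  open import Relation.Binary.Reasoning.Setoid setoid
  open IsStrictTotalOrder isStrictTotalOrder
    using (compare; _<?_; <-resp-≈)
    renaming (trans to <-trans; irrefl to <-irrefl; asym to <-asym)

  -- Ordered field arithmetic

  -- This serves two ends: coefficients for the ring solver, whose equality test then computes in ℤ,
  -- and coordinates for the integer points of the charts.
  fromℤ : ℤ → Carrier
  fromℤ (+ n)    = n ×ₙ 1#
  fromℤ -[1+ n ] = - (suc n ×ₙ 1#)

  fromℤ-⊖ : ∀ m n → fromℤ (m ⊖ n) ≈ m ×ₙ 1# - n ×ₙ 1#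
  fromℤ-⊖ m zero = begin
    m ×ₙ 1#        ≈⟨ +-identityʳ _ ⟨
    m ×ₙ 1# + 0#   ≈⟨ +-congˡ -0#≈0# ⟨
    m ×ₙ 1# - 0#   ∎
  fromℤ-⊖ zero (suc n) = sym (+-identityˡ _)
  fromℤ-⊖ (suc m) (suc n) = begin
    fromℤ (suc m ⊖ suc n)               ≡⟨ ≡.cong fromℤ (ℤ.[1+m]⊖[1+n]≡m⊖n m n) ⟩
    fromℤ (m ⊖ n)                       ≈⟨ fromℤ-⊖ m n ⟩
    m ×ₙ 1# - n ×ₙ 1#                   ≈⟨ +-congʳ (+-identityˡ _) ⟨
    (0# + m ×ₙ 1#) - n ×ₙ 1#            ≈⟨ +-congʳ (+-congʳ (-‿inverseʳ 1#)) ⟨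
    ((1# - 1#) + m ×ₙ 1#) - n ×ₙ 1#     ≈⟨ +-congʳ (+-assoc _ _ _) ⟩
    (1# + (- 1# + m ×ₙ 1#)) - n ×ₙ 1#   ≈⟨ +-congʳ (+-congˡ (+-comm _ _)) ⟩
    (1# + (m ×ₙ 1# - 1#)) - n ×ₙ 1#     ≈⟨ +-congʳ (+-assoc _ _ _) ⟨
    ((1# + m ×ₙ 1#) - 1#) - n ×ₙ 1#     ≈⟨ +-assoc _ _ _ ⟩
    (1# + m ×ₙ 1#) + (- 1# - n ×ₙ 1#)   ≈⟨ +-cong (1+× m 1#) (trans (-‿cong (1+× n 1#)) (sym (-‿+-comm 1# _))) ⟨
    suc m ×ₙ 1# - suc n ×ₙ 1#           ∎

  fromℤ-neg : ∀ i → fromℤ (ℤ.- i) ≈ - fromℤ i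
  fromℤ-neg (+ zero)  = sym -0#≈0#
  fromℤ-neg (+ suc n) = refl
  fromℤ-neg -[1+ n ]  = sym (-‿involutive _)

  fromℤ-+ : ∀ i j → fromℤ (i ℤ.+ j) ≈ fromℤ i + fromℤ j
  fromℤ-+ (+ m)    (+ n)    = ×-homo-+ 1# m n
  fromℤ-+ (+ m)    -[1+ n ] = fromℤ-⊖ m (suc n)
  fromℤ-+ -[1+ m ] (+ n)    = trans (fromℤ-⊖ n (suc m)) (+-comm _ _)
  fromℤ-+ -[1+ m ] -[1+ n ] = begin
    - (suc (suc (m ℕ.+ n)) ×ₙ 1#)       ≡⟨ ≡.cong (λ k → - (k ×ₙ 1#)) (≡.sym (ℕ.+-suc (suc m) n)) ⟩
    - ((suc m ℕ.+ suc n) ×ₙ 1#)         ≈⟨ -‿cong (×-homo-+ 1# (suc m) (suc n)) ⟩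
    - (suc m ×ₙ 1# + suc n ×ₙ 1#)       ≈⟨ -‿+-comm _ _ ⟨
    - (suc m ×ₙ 1#) - suc n ×ₙ 1#       ∎

  fromℤ-pos-* : ∀ m j → fromℤ (+ m ℤ.* j) ≈ fromℤ (+ m) * fromℤ j
  fromℤ-pos-* m (+ n) = begin
    fromℤ (+ m ℤ.* + n)     ≡⟨ ≡.cong fromℤ (ℤ.pos-* m n) ⟨
    (m ℕ.* n) ×ₙ 1#         ≈⟨ ×1-homo-* m n ⟩
    (m ×ₙ 1#) * (n ×ₙ 1#)   ∎
  fromℤ-pos-* m -[1+ n ] = begin
    fromℤ (+ m ℤ.* -[1+ n ])          ≡⟨ ≡.cong fromℤ (ℤ.neg-distribʳ-* (+ m) (+ suc n)) ⟨
    fromℤ (ℤ.- (+ m ℤ.* + suc n))     ≈⟨ fromℤ-neg (+ m ℤ.* + suc n) ⟩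
    - fromℤ (+ m ℤ.* + suc n)         ≈⟨ -‿cong (fromℤ-pos-* m (+ suc n)) ⟩
    - ((m ×ₙ 1#) * (suc n ×ₙ 1#))     ≈⟨ -‿distribʳ-* _ _ ⟩
    (m ×ₙ 1#) * - (suc n ×ₙ 1#)       ∎

  fromℤ-* : ∀ i j → fromℤ (i ℤ.* j) ≈ fromℤ i * fromℤ j
  fromℤ-* (+ m)    j = fromℤ-pos-* m j
  fromℤ-* -[1+ m ] j = begin
    fromℤ (-[1+ m ] ℤ.* j)          ≡⟨ ≡.cong fromℤ (ℤ.neg-distribˡ-* (+ suc m) j) ⟨
    fromℤ (ℤ.- (+ suc m ℤ.* j))     ≈⟨ fromℤ-neg (+ suc m ℤ.* j) ⟩
    - fromℤ (+ suc m ℤ.* j)         ≈⟨ -‿cong (fromℤ-pos-* (suc m) j) ⟩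
    - ((suc m ×ₙ 1#) * fromℤ j)     ≈⟨ -‿distribˡ-* _ _ ⟩
    - (suc m ×ₙ 1#) * fromℤ j       ∎

  fromℤ-homomorphism : ℤ.+-*-rawRing -Raw-AlmostCommutative⟶ fromCommutativeRing commutativeRing
  fromℤ-homomorphism = record
    { ⟦_⟧    = fromℤ
    ; +-homo = fromℤ-+
    ; *-homo = fromℤ-*
    ; -‿homo = fromℤ-neg
    ; 0-homo = refl
    ; 1-homo = refl
    }

  open RingSolver ℤ.+-*-rawRing (fromCommutativeRing commutativeRing) fromℤ-homomorphism
    (λ i j → Maybe.map (λ i≡j → reflexive (≡.cong fromℤ i≡j)) (dec⇒maybe (i ℤ.≟ j)))
    using (solve; con; _:+_; _:*_; _:-_; :-_; _:=_)

  <-respʳ : ∀ {x y z} → y ≈ z → x < y → x < z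
  <-respʳ = proj₁ <-resp-≈

  <-respˡ : ∀ {x y z} → y ≈ z → y < x → z < x
  <-respˡ = proj₂ <-resp-≈

  ≤-respʳ : ∀ {x y z} → y ≈ z → x ≤ y → x ≤ z
  ≤-respʳ y≈z (inj₁ x<y) = inj₁ (<-respʳ y≈z x<y)
  ≤-respʳ y≈z (inj₂ x≈y) = inj₂ (trans x≈y y≈z)

  ≮⇒≥ : ∀ {x y} → ¬ x < y → y ≤ x
  ≮⇒≥ {x} {y} x≮y with compare x y
  ... | tri< x<y _ _ = ⊥-elim (x≮y x<y)
  ... | tri≈ _ x≈y _ = inj₂ (sym x≈y)
  ... | tri> _ _ y<x = inj₁ y<x

  ≤⇒≯ : ∀ {x y} → x ≤ y → ¬ y < x
  ≤⇒≯ (inj₁ x<y) y<x = <-asym x<y y<x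
  ≤⇒≯ (inj₂ x≈y) y<x = <-irrefl (sym x≈y) y<x

  ≤∧≮⇒≈ : ∀ {x y} → x ≤ y → ¬ x < y → x ≈ y
  ≤∧≮⇒≈ (inj₁ x<y) x≮y = ⊥-elim (x≮y x<y)
  ≤∧≮⇒≈ (inj₂ x≈y) _   = x≈y

  <⇒0< : ∀ {x y} → x < y → 0# < y - x
  <⇒0< {x} x<y = <-respˡ (-‿inverseʳ x) (+-mono-< (- x) x<y)

  -- The usual pattern for inequalities below: the solver rewrites the difference `y - x` as a
  -- combination `z` of terms of known sign.
  0<⇒< : ∀ {x y z} → y - x ≈ z → 0# < z → x < y
  0<⇒< {x} {y} {z} eq 0<z = <-respˡ (+-identityˡ x) (<-respʳ step (+-mono-< x 0<z))
    where
    step : z + x ≈ y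
    step = trans (+-congʳ (sym eq)) (solve 2 (λ x y → (y :- x) :+ x := y) refl x y)

  ≤⇒0≤ : ∀ {x y} → x ≤ y → 0# ≤ y - x
  ≤⇒0≤ (inj₁ x<y) = inj₁ (<⇒0< x<y)
  ≤⇒0≤ {x} (inj₂ x≈y) = inj₂ (sym (trans (+-congʳ (sym x≈y)) (-‿inverseʳ x)))

  0≤⇒≤ : ∀ {x y z} → y - x ≈ z → 0# ≤ z → x ≤ y
  0≤⇒≤ eq (inj₁ 0<z) = inj₁ (0<⇒< eq 0<z)
  0≤⇒≤ {x} {y} {z} eq (inj₂ 0≈z) = inj₂ (sym (begin
    y            ≈⟨ solve 2 (λ x y → y := (y :- x) :+ x) refl x y ⟩
    (y - x) + x  ≈⟨ +-congʳ (trans eq (sym 0≈z)) ⟩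
    0# + x       ≈⟨ +-identityˡ x ⟩
    x            ∎))

  +-pos-nonneg : ∀ {x y} → 0# < x → 0# ≤ y → 0# < x + y
  +-pos-nonneg {x} {y} 0<x (inj₁ 0<y) = <-trans 0<y (<-respˡ (+-identityˡ y) (+-mono-< y 0<x))
  +-pos-nonneg {x} {y} 0<x (inj₂ 0≈y) = <-respʳ (trans (sym (+-identityʳ x)) (+-congˡ 0≈y)) 0<x

  +-pos : ∀ {x y} → 0# < x → 0# < y → 0# < x + y
  +-pos 0<x 0<y = +-pos-nonneg 0<x (inj₁ 0<y)

  +-nonneg : ∀ {x y} → 0# ≤ x → 0# ≤ y → 0# ≤ x + y
  +-nonneg (inj₁ 0<x) 0≤y = inj₁ (+-pos-nonneg 0<x 0≤y)
  +-nonneg {x} {y} (inj₂ 0≈x) 0≤y = ≤-respʳ (trans (sym (+-identityˡ y)) (+-congʳ 0≈x)) 0≤y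

  *-nonneg : ∀ {x y} → 0# ≤ x → 0# ≤ y → 0# ≤ x * y
  *-nonneg (inj₁ 0<x) (inj₁ 0<y) = inj₁ (*-pos 0<x 0<y)
  *-nonneg {x} {y} (inj₂ 0≈x) _  = inj₂ (trans (sym (zeroˡ y)) (*-congʳ 0≈x))
  *-nonneg {x} {y} _ (inj₂ 0≈y)  = inj₂ (trans (sym (zeroʳ x)) (*-congˡ 0≈y))

  ≤-refl : ∀ {x} → x ≤ x
  ≤-refl = inj₂ refl

  ≤-trans : ∀ {x y z} → x ≤ y → y ≤ z → x ≤ z
  ≤-trans {x} {y} {z} x≤y y≤z = 0≤⇒≤ (solve 3 (λ x y z → z :- x := (y :- x) :+ (z :- y)) refl x y z)
    (+-nonneg (≤⇒0≤ x≤y) (≤⇒0≤ y≤z))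

  <-≤-trans : ∀ {x y z} → x < y → y ≤ z → x < z
  <-≤-trans {x} {y} {z} x<y y≤z = 0<⇒< (solve 3 (λ x y z → z :- x := (y :- x) :+ (z :- y)) refl x y z)
    (+-pos-nonneg (<⇒0< x<y) (≤⇒0≤ y≤z))

  ≤-<-trans : ∀ {x y z} → x ≤ y → y < z → x < z
  ≤-<-trans {x} {y} {z} x≤y y<z = 0<⇒< (solve 3 (λ x y z → z :- x := (z :- y) :+ (y :- x)) refl x y z)
    (+-pos-nonneg (<⇒0< y<z) (≤⇒0≤ x≤y))

  0<1 : 0# < 1#
  0<1 with compare 0# 1#
  ... | tri< 0<1 _ _ = 0<1
  ... | tri≈ _ 0≈1 _ = ⊥-elim (0≉1 0≈1)
  ... | tri> _ _ 1<0 = <-respʳ (solve 0 ((con (+ 0) :- con (+ 1)) :* (con (+ 0) :- con (+ 1)) := con (+ 1)) refl)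
    (*-pos (<⇒0< 1<0) (<⇒0< 1<0))

  reciprocal : ∀ {x} → 0# < x → ∃[ y ] 0# < y × x * y ≈ 1#
  reciprocal {x} 0<x with inverse x (λ x≈0 → <-irrefl (sym x≈0) 0<x)
  ... | y , xy≈1 with compare 0# y
  ... | tri< 0<y _ _ = y , 0<y , xy≈1
  ... | tri≈ _ 0≈y _ = ⊥-elim (0≉1 (trans (sym (zeroʳ x)) (trans (*-congˡ 0≈y) xy≈1)))
  ... | tri> _ _ y<0 = ⊥-elim (<-irrefl (sym step) (+-pos 0<1 (*-pos 0<x (<⇒0< y<0))))
    where
    step : 1# + x * (0# - y) ≈ 0#
    step = trans (+-congʳ (sym xy≈1)) (solve 2 (λ x y → x :* y :+ x :* (con (+ 0) :- y) := con (+ 0)) refl x y)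

  halve : ∀ {ε} → 0# < ε → ∃[ δ ] 0# < δ × δ + δ ≈ ε
  halve {ε} 0<ε with reciprocal (+-pos 0<1 0<1)
  ... | h , 0<h , 2h≈1 = ε * h , *-pos 0<ε 0<h , (begin
    ε * h + ε * h        ≈⟨ solve 2 (λ e h → e :* h :+ e :* h := e :* ((con (+ 1) :+ con (+ 1)) :* h)) refl ε h ⟩
    ε * ((1# + 1#) * h)  ≈⟨ *-congˡ 2h≈1 ⟩
    ε * 1#               ≈⟨ *-identityʳ ε ⟩
    ε                    ∎)

  meet : ∀ {x y} → 0# < x → 0# < y → ∃[ z ] 0# < z × z ≤ x × z ≤ y
  meet {x} {y} 0<x 0<y with x <? y
  ... | yes x<y = x , 0<x , ≤-refl , inj₁ x<y
  ... | no x≮y  = y , 0<y , ≮⇒≥ x≮y , ≤-refl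

  ⋀ : ∀ {k} {P : Fin k → Carrier → Set} → (∀ i {δ ε} → 0# < δ → δ ≤ ε → P i ε → P i δ) →
      (∀ i → ∃[ ε ] 0# < ε × P i ε) → ∃[ ε ] 0# < ε × (∀ i → P i ε)
  ⋀ {zero}  down f = 1# , 0<1 , λ ()
  ⋀ {suc k} down f with f zero | ⋀ (λ i → down (suc i)) (λ i → f (suc i))
  ... | ε , 0<ε , p | ε′ , 0<ε′ , p′ with meet 0<ε 0<ε′
  ... | δ , 0<δ , δ≤ε , δ≤ε′ = δ , 0<δ , λ where
    zero    → down zero 0<δ δ≤ε p
    (suc i) → down (suc i) 0<δ δ≤ε′ (p′ i)

  infix 10 _⁺

  _⁺ : Carrier → Carrier
  x ⁺ with 0# <? x
  ... | yes _ = x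
  ... | no  _ = 0#

  ⁺-nonneg : ∀ x → 0# ≤ x ⁺
  ⁺-nonneg x with 0# <? x
  ... | yes 0<x = inj₁ 0<x
  ... | no  _   = ≤-refl

  ⁺-≥ : ∀ x → x ≤ x ⁺
  ⁺-≥ x with 0# <? x
  ... | yes _   = ≤-refl
  ... | no 0≮x  = ≮⇒≥ 0≮x

  ⁺-pos : ∀ {x} → 0# ≤ x → x ⁺ ≈ x
  ⁺-pos {x} 0≤x with 0# <? x
  ... | yes _  = refl
  ... | no 0≮x = ≤∧≮⇒≈ 0≤x 0≮x

  ⁺-neg : ∀ {x} → x ≤ 0# → x ⁺ ≈ 0#
  ⁺-neg {x} x≤0 with 0# <? x
  ... | yes 0<x = ⊥-elim (≤⇒≯ x≤0 0<x)
  ... | no _ = refl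

  ⁺-≤ : ∀ {x y} → x ≤ y → 0# ≤ y → x ⁺ ≤ y
  ⁺-≤ {x} x≤y 0≤y with 0# <? x
  ... | yes _ = x≤y
  ... | no _ = 0≤y

  shrink : ∀ {δ} → 0# < δ → ∃[ η ] 0# < η × η < δ
  shrink {δ} 0<δ = smaller (halve 0<δ)
    where
    smaller : (∃[ η ] 0# < η × η + η ≈ δ) → ∃[ η ] 0# < η × η < δ
    smaller (η , 0<η , η+η≈δ) =
      η , 0<η , 0<⇒< (trans (+-congʳ (sym η+η≈δ)) (solve 1 (λ h → (h :+ h) :- h := h) refl η)) 0<η

  -- Continuity, open sets and convex sets

  infix 4 _≋_
  _≋_ : ∀ {d} → Point ℝ d → Point ℝ d → Set
  p ≋ q = ∀ i → p i ≈ q i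

  -- In this form closeness is the positivity of two ring expressions, so estimates reduce to ring
  -- identities and sums of nonnegative terms.
  close : ∀ {ε x y} → 0# < (y - x) + ε → 0# < (x - y) + ε → Close ℝ ε x y
  close {ε} {x} {y} l u =
    0<⇒< (solve 3 (λ e x y → y :- (x :- e) := (y :- x) :+ e) refl ε x y) l ,
    0<⇒< (solve 3 (λ e x y → (x :+ e) :- y := (x :- y) :+ e) refl ε x y) u

  close⇒lower : ∀ {ε x y} → Close ℝ ε x y → 0# < (y - x) + ε
  close⇒lower {ε} {x} {y} (l , _) =
    <-respʳ (solve 3 (λ e x y → y :- (x :- e) := (y :- x) :+ e) refl ε x y) (<⇒0< l)

  close⇒upper : ∀ {ε x y} → Close ℝ ε x y → 0# < (x - y) + ε
  close⇒upper {ε} {x} {y} (_ , u) =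
    <-respʳ (solve 3 (λ e x y → (x :+ e) :- y := (x :- y) :+ e) refl ε x y) (<⇒0< u)

  close-mono : ∀ {δ ε x y} → δ ≤ ε → Close ℝ δ x y → Close ℝ ε x y
  close-mono {δ} {ε} {x} {y} δ≤ε c = close (widen (close⇒lower c)) (widen (close⇒upper c))
    where
    widen : ∀ {z} → 0# < z + δ → 0# < z + ε
    widen {z} 0<z+δ = <-respʳ (solve 3 (λ z d e → (z :+ d) :+ (e :- d) := z :+ e) refl z δ ε)
      (+-pos-nonneg 0<z+δ (≤⇒0≤ δ≤ε))

  ≈⇒close : ∀ {ε x y} → 0# < ε → x ≈ y → Close ℝ ε x y
  ≈⇒close {ε} {x} {y} 0<ε x≈y = close
    (<-respʳ (sym (trans (+-congʳ (trans (+-congˡ (-‿cong x≈y)) (-‿inverseʳ y))) (+-identityˡ ε))) 0<ε)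
    (<-respʳ (sym (trans (+-congʳ (trans (+-congʳ x≈y) (-‿inverseʳ y))) (+-identityˡ ε))) 0<ε)

  close-+ : ∀ {δ ε x y x′ y′} → Close ℝ δ x x′ → Close ℝ ε y y′ → Close ℝ (δ + ε) (x + y) (x′ + y′)
  close-+ {δ} {ε} {x} {y} {x′} {y′} c c′ = close
    (<-respʳ (regroup x x′ y y′) (+-pos (close⇒lower c) (close⇒lower c′)))
    (<-respʳ (regroup x′ x y′ y) (+-pos (close⇒upper c) (close⇒upper c′)))
    where
    regroup : ∀ x x′ y y′ → ((x′ - x) + δ) + ((y′ - y) + ε) ≈ ((x′ + y′) - (x + y)) + (δ + ε)
    regroup = solve 6 (λ d e x x′ y y′ →
      ((x′ :- x) :+ d) :+ ((y′ :- y) :+ e) := ((x′ :+ y′) :- (x :+ y)) :+ (d :+ e)) refl δ ε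

  close-neg : ∀ {ε x y} → Close ℝ ε x y → Close ℝ ε (- x) (- y)
  close-neg {ε} {x} {y} c = close (<-respʳ (swap x y) (close⇒upper c)) (<-respʳ (swap y x) (close⇒lower c))
    where
    swap : ∀ x y → (x - y) + ε ≈ (- y - - x) + ε
    swap = solve 3 (λ e x y → (x :- y) :+ e := (:- y :- :- x) :+ e) refl ε

  close-scale : ∀ {ε v x y} → 0# < v → Close ℝ ε x y → Close ℝ (ε * v) (x * v) (y * v)
  close-scale {ε} {v} {x} {y} 0<v c = close
    (<-respʳ (expand y x) (*-pos (close⇒lower c) 0<v)) (<-respʳ (expand x y) (*-pos (close⇒upper c) 0<v))
    where
    expand : ∀ x y → ((x - y) + ε) * v ≈ (x * v - y * v) + ε * v
    expand = solve 4 (λ e v x y → ((x :- y) :+ e) :* v := (x :* v :- y :* v) :+ e :* v) refl ε v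

  close-⁺ : ∀ {ε x y} → 0# < ε → Close ℝ ε x y → Close ℝ ε (x ⁺) (y ⁺)
  close-⁺ {ε} {x} {y} 0<ε c = close (bound (close⇒lower c)) (bound (close⇒upper c))
    where
    bound : ∀ {x y} → 0# < (y - x) + ε → 0# < (y ⁺ - x ⁺) + ε
    bound {x} {y} 0<y-x+ε with 0# <? x
    ... | yes _ = <-respʳ (solve 4 (λ e x y y⁺ → ((y :- x) :+ e) :+ (y⁺ :- y) := (y⁺ :- x) :+ e) refl ε x y (y ⁺))
      (+-pos-nonneg 0<y-x+ε (≤⇒0≤ (⁺-≥ y)))
    ... | no _ = <-respʳ (solve 2 (λ e y⁺ → e :+ y⁺ := (y⁺ :- con (+ 0)) :+ e) refl ε (y ⁺))
      (+-pos-nonneg 0<ε (⁺-nonneg y))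

  Continuous : ∀ {k} → (Point ℝ k → Carrier) → Set
  Continuous g = ∀ p ε → 0# < ε → ∃[ δ ] 0# < δ × (∀ q → Near ℝ δ p q → Close ℝ ε (g p) (g q))

  module _ {k : ℕ} where

    cont-proj : ∀ i → Continuous {k} (λ p → p i)
    cont-proj i p ε 0<ε = ε , 0<ε , λ q near → near i

    cont-const : ∀ c → Continuous {k} (λ _ → c)
    cont-const c p ε 0<ε = ε , 0<ε , λ q near → ≈⇒close 0<ε refl

    cont-+ : ∀ {g h : Point ℝ k → Carrier} → Continuous g → Continuous h → Continuous (λ p → g p + h p)
    cont-+ cg ch p ε 0<ε =
      let η , 0<η , η+η≈ε = halve 0<ε
          δ₁ , 0<δ₁ , c₁ = cg p η 0<η
          δ₂ , 0<δ₂ , c₂ = ch p η 0<η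
          δ , 0<δ , δ≤δ₁ , δ≤δ₂ = meet 0<δ₁ 0<δ₂
      in δ , 0<δ , λ q near →
        close-mono (inj₂ η+η≈ε) (close-+ (c₁ q (close-mono δ≤δ₁ ∘ near)) (c₂ q (close-mono δ≤δ₂ ∘ near)))

    cont-neg : ∀ {g : Point ℝ k → Carrier} → Continuous g → Continuous (λ p → - g p)
    cont-neg cg p ε 0<ε with cg p ε 0<ε
    ... | δ , 0<δ , c = δ , 0<δ , λ q near → close-neg (c q near)

    cont-⁺ : ∀ {g : Point ℝ k → Carrier} → Continuous g → Continuous (λ p → g p ⁺)
    cont-⁺ cg p ε 0<ε with cg p ε 0<ε
    ... | δ , 0<δ , c = δ , 0<δ , λ q near → close-⁺ 0<ε (c q near)

    cont-cong : ∀ {g h : Point ℝ k → Carrier} → (∀ p → g p ≈ h p) → Continuous g → Continuous h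
    cont-cong g≈h cg p ε 0<ε with cg p ε 0<ε
    ... | δ , 0<δ , c = δ , 0<δ , λ q near →
      let l , u = c q near in
      <-respʳ (g≈h q) (<-respˡ (+-congʳ (g≈h p)) l) , <-respˡ (g≈h q) (<-respʳ (+-congʳ (g≈h p)) u)

    cont-scale-pos : ∀ {g : Point ℝ k → Carrier} {v} → 0# < v → Continuous g → Continuous (λ p → g p * v)
    cont-scale-pos {v = v} 0<v cg p ε 0<ε with reciprocal 0<v
    ... | w , 0<w , vw≈1 with cg p (ε * w) (*-pos 0<ε 0<w)
    ... | δ , 0<δ , c = δ , 0<δ , λ q near → close-mono (inj₂ cancel) (close-scale 0<v (c q near))
      where
      cancel : (ε * w) * v ≈ ε
      cancel = begin
        (ε * w) * v  ≈⟨ solve 3 (λ e w v → (e :* w) :* v := e :* (v :* w)) refl ε w v ⟩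
        ε * (v * w)  ≈⟨ *-congˡ vw≈1 ⟩
        ε * 1#       ≈⟨ *-identityʳ ε ⟩
        ε            ∎

    cont-scale : ∀ {g : Point ℝ k → Carrier} v → Continuous g → Continuous (λ p → g p * v)
    cont-scale {g} v cg with compare 0# v
    ... | tri< 0<v _ _ = cont-scale-pos 0<v cg
    ... | tri≈ _ 0≈v _ = cont-cong (λ p → trans (sym (zeroʳ (g p))) (*-congˡ 0≈v)) (cont-const 0#)
    ... | tri> _ _ v<0 = cont-cong (λ p → solve 2 (λ x v → :- (x :* (con (+ 0) :- v)) := x :* v) refl (g p) v)
      (cont-neg (cont-scale-pos (<⇒0< v<0) cg))

    cont-sum : ∀ {n} {g : Fin n → Point ℝ k → Carrier} → (∀ i → Continuous (g i)) → Continuous (λ p → sum (λ i → g i p))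
    cont-sum {zero}  cg = cont-const 0#
    cont-sum {suc n} cg = cont-+ (cg zero) (cont-sum (cg ∘ suc))

    Continuous* : ∀ {m} → (Point ℝ k → Point ℝ m) → Set
    Continuous* G = ∀ i → Continuous (λ p → G p i)

    near-image : ∀ {m} {G : Point ℝ k → Point ℝ m} → Continuous* G → ∀ p ε → 0# < ε →
                 ∃[ δ ] 0# < δ × (∀ q → Near ℝ δ p q → Near ℝ ε (G p) (G q))
    near-image cG p ε 0<ε =
      let δ , 0<δ , c = ⋀ (λ i _ δ≤η c q near → c q (close-mono δ≤η ∘ near)) (λ i → cG i p ε 0<ε)
      in δ , 0<δ , λ q near i → c i q near

    cont-∘ : ∀ {m} {g : Point ℝ m → Carrier} {G : Point ℝ k → Point ℝ m} →
             Continuous g → Continuous* G → Continuous (g ∘ G)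
    cont-∘ {G = G} cg cG p ε 0<ε =
      let η , 0<η , c  = cg (G p) ε 0<ε
          δ , 0<δ , c′ = near-image cG p η 0<η
      in δ , 0<δ , λ q near → c (G q) (c′ q near)

    open-preimage : ∀ {m} {U : Pred (Point ℝ m) 0ℓ} {G : Point ℝ k → Point ℝ m} →
                    Continuous* G → IsOpen ℝ U → IsOpen ℝ (U ∘ G)
    open-preimage {G = G} cG open-U p Gp∈U =
      let ε , 0<ε , ball = open-U (G p) Gp∈U
          δ , 0<δ , c    = near-image cG p ε 0<ε
      in δ , 0<δ , λ q near → ball (G q) (c q near)

    open-positive : ∀ {g : Point ℝ k → Carrier} → Continuous g → IsOpen ℝ (λ p → 0# < g p)
    open-positive {g} cg p 0<gp with cg p (g p) 0<gp
    ... | δ , 0<δ , c = δ , 0<δ , λ q near → <-respˡ (-‿inverseʳ (g p)) (proj₁ (c q near))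

    open-∩ : ∀ {U V : Pred (Point ℝ k) 0ℓ} → IsOpen ℝ U → IsOpen ℝ V → IsOpen ℝ (U ∩ V)
    open-∩ oU oV p (p∈U , p∈V) =
      let δ₁ , 0<δ₁ , b₁ = oU p p∈U
          δ₂ , 0<δ₂ , b₂ = oV p p∈V
          δ , 0<δ , δ≤δ₁ , δ≤δ₂ = meet 0<δ₁ 0<δ₂
      in δ , 0<δ , λ q near → b₁ q (close-mono δ≤δ₁ ∘ near) , b₂ q (close-mono δ≤δ₂ ∘ near)

    open-∀ : ∀ {m} {U : Fin m → Pred (Point ℝ k) 0ℓ} → (∀ i → IsOpen ℝ (U i)) → IsOpen ℝ (λ p → ∀ i → U i p)
    open-∀ oU p p∈U =
      let δ , 0<δ , b = ⋀ (λ i _ δ≤η b q near → b q (close-mono δ≤η ∘ near)) (λ i → oU i p (p∈U i))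
      in δ , 0<δ , λ q near i → b i q near

    open-All : ∀ {A : Set} {U : A → Pred (Point ℝ k) 0ℓ} → (∀ a → IsOpen ℝ (U a)) →
               ∀ as → IsOpen ℝ (λ p → All (λ a → U a p) as)
    open-All oU []       p []          = 1# , 0<1 , λ _ _ → []
    open-All oU (a ∷ as) p (pa ∷ pas) =
      let δ , 0<δ , b = open-∩ (oU a) (open-All oU as) p (pa , pas)
      in δ , 0<δ , λ q near → proj₁ (b q near) ∷ proj₂ (b q near)

    open-⇒ : ∀ {A : Set} {U : Pred (Point ℝ k) 0ℓ} → Dec A → IsOpen ℝ U → IsOpen ℝ (λ p → A → U p)
    open-⇒ (yes a) oU p f with oU p (f a)
    ... | δ , 0<δ , b = δ , 0<δ , λ q near _ → b q near
    open-⇒ (no ¬a) oU p f = 1# , 0<1 , λ _ _ a → ⊥-elim (¬a a)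

    open-≐ : ∀ {U V : Pred (Point ℝ k) 0ℓ} → U ≐ V → IsOpen ℝ U → IsOpen ℝ V
    open-≐ (U⊆V , V⊆U) oU p p∈V with oU p (V⊆U p∈V)
    ... | δ , 0<δ , b = δ , 0<δ , λ q near → U⊆V (b q near)

    -- A predicate on points need not respect `_≈_`, but every neighbourhood of `p` contains all
    -- points equal to `p`, so an open one does.
    open-resp : ∀ {U : Pred (Point ℝ k) 0ℓ} → IsOpen ℝ U → ∀ {p q} → p ≋ q → U p → U q
    open-resp oU p≋q p∈U with oU _ p∈U
    ... | δ , 0<δ , b = b _ (λ i → ≈⇒close 0<δ (p≋q i))

  between : ∀ {d} → Point ℝ d → Point ℝ d → Carrier → Point ℝ d
  between p q t i = (1# - t) * p i + t * q i

  Affine : ∀ {k} → (Point ℝ k → Carrier) → Set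
  Affine g = ∀ p q t → g (between p q t) ≈ (1# - t) * g p + t * g q

  affine-sum : ∀ {k n} {g : Fin n → Point ℝ k → Carrier} → (∀ i → Affine (g i)) → Affine (λ p → sum (λ i → g i p))
  affine-sum {n = zero}  ag p q t = solve 1 (λ t → con (+ 0) := (con (+ 1) :- t) :* con (+ 0) :+ t :* con (+ 0)) refl t
  affine-sum {n = suc n} {g} ag p q t = trans (+-cong (ag zero p q t) (affine-sum (ag ∘ suc) p q t))
    (solve 5 (λ t x y x′ y′ →
      ((con (+ 1) :- t) :* x :+ t :* y) :+ ((con (+ 1) :- t) :* x′ :+ t :* y′) :=
      (con (+ 1) :- t) :* (x :+ x′) :+ t :* (y :+ y′)) refl
      t (g zero p) (g zero q) (sum (λ i → g (suc i) p)) (sum (λ i → g (suc i) q)))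

  convex-positive : ∀ {k} {g : Point ℝ k → Carrier} → Affine g → IsConvex ℝ (λ p → 0# < g p)
  convex-positive {g = g} ag p q 0<gp 0<gq t (inj₂ 0≈t) t≤1 = <-respʳ (sym (trans (ag p q t) (begin
    (1# - t) * g p + t * g q    ≈⟨ +-cong (*-congʳ (+-congˡ (-‿cong 0≈t))) (*-congʳ 0≈t) ⟨
    (1# - 0#) * g p + 0# * g q  ≈⟨ solve 2 (λ x y → (con (+ 1) :- con (+ 0)) :* x :+ con (+ 0) :* y := x) refl (g p) (g q) ⟩
    g p                         ∎))) 0<gp
  convex-positive {g = g} ag p q 0<gp 0<gq t (inj₁ 0<t) t≤1 = <-respʳ (sym (trans (ag p q t) (+-comm _ _)))
    (+-pos-nonneg (*-pos 0<t 0<gq) (*-nonneg (≤⇒0≤ t≤1) (inj₁ 0<gp)))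

  convex-All : ∀ {k} {A : Set} {U : A → Pred (Point ℝ k) 0ℓ} → (∀ a → IsConvex ℝ (U a)) →
               ∀ as → IsConvex ℝ (λ p → All (λ a → U a p) as)
  convex-All cU []       p q []         []         t 0≤t t≤1 = []
  convex-All cU (a ∷ as) p q (pa ∷ pas) (qa ∷ qas) t 0≤t t≤1 =
    cU a p q pa qa t 0≤t t≤1 ∷ convex-All cU as p q pas qas t 0≤t t≤1

  -- Non-convexity

  between-0 : ∀ {d} (p q : Point ℝ d) {t} → t ≈ 0# → between p q t ≋ p
  between-0 p q {t} t≈0 i = begin
    (1# - t) * p i + t * q i    ≈⟨ +-cong (*-congʳ (+-congˡ (-‿cong t≈0))) (*-congʳ t≈0) ⟩
    (1# - 0#) * p i + 0# * q i  ≈⟨ solve 2 (λ p q → (con (+ 1) :- con (+ 0)) :* p :+ con (+ 0) :* q := p) refl (p i) (q i) ⟩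
    p i                         ∎

  between-1 : ∀ {d} (p q : Point ℝ d) {t} → t ≈ 1# → between p q t ≋ q
  between-1 p q {t} t≈1 i = begin
    (1# - t) * p i + t * q i    ≈⟨ +-cong (*-congʳ (+-congˡ (-‿cong t≈1))) (*-congʳ t≈1) ⟩
    (1# - 1#) * p i + 1# * q i  ≈⟨ solve 2 (λ p q → (con (+ 1) :- con (+ 1)) :* p :+ con (+ 1) :* q := q) refl (p i) (q i) ⟩
    q i                         ∎

  ≋-sym : ∀ {d} {p q : Point ℝ d} → p ≋ q → q ≋ p
  ≋-sym p≋q i = sym (p≋q i)

  module _ {d : ℕ} {A : Pred (Point ℝ d) 0ℓ} (open-A : IsOpen ℝ A) (p q : Point ℝ d) where

    open-segment : ∀ s → A (between p q s) → ∃[ δ ] 0# < δ × (∀ t → Close ℝ δ s t → A (between p q t))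
    open-segment s As =
      let δ , 0<δ , ball = open-preimage {G = λ τ → between p q (τ zero)} continuous open-A (λ (_ : Fin 1) → s) As
      in δ , 0<δ , λ t c → ball (λ _ → t) (λ _ → c)
      where
      continuous : ∀ i → Continuous {1} (λ τ → (1# - τ zero) * p i + τ zero * q i)
      continuous i = cont-+ (cont-scale (p i) (cont-+ (cont-const 1#) (cont-neg (cont-proj zero)))) (cont-scale (q i) (cont-proj zero))

  OnSegment : ∀ {d} → Pred (Point ℝ d) 0ℓ → Point ℝ d → Point ℝ d → Pred Carrier 0ℓ
  OnSegment A p q t = 0# ≤ t × t ≤ 1# × A (between p q t)

  -- `s` is the supremum of the parameters at which the segment lies in `A`; whether it is attained
  -- is left open. Leastness only refutes the absence of parameters close to `s`, hence the double
  -- negation in `approach`.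
  record Last {d} (A : Pred (Point ℝ d) 0ℓ) (p q : Point ℝ d) : Set where
    field
      s        : Carrier
      0≤s      : 0# ≤ s
      s≤1      : s ≤ 1#
      upper    : ∀ {t} → OnSegment A p q t → t ≤ s
      approach : ∀ {δ} → 0# < δ → ¬ ¬ (∃[ t ] OnSegment A p q t × Close ℝ δ s t)

  last : ∀ {d} {A : Pred (Point ℝ d) 0ℓ} → IsOpen ℝ A → ∀ {p} q → A p → Last A p q
  last {A = A} open-A {p} q p∈A =
    build (supremum (OnSegment A p q) (0# , 0∈segment) (1# , λ t (_ , t≤1 , _) → t≤1))
    where
    0∈segment : OnSegment A p q 0#
    0∈segment = ≤-refl , inj₁ 0<1 , open-resp open-A (≋-sym (between-0 p q refl)) p∈A

    build : (∃[ s ] UpperBound (OnSegment A p q) s × (∀ b → UpperBound (OnSegment A p q) b → s ≤ b)) → Last A p q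
    build (s , upper , least) = record
      { s        = s
      ; 0≤s      = upper 0# 0∈segment
      ; s≤1      = least 1# (λ t (_ , t≤1 , _) → t≤1)
      ; upper    = upper _
      ; approach = λ {δ} 0<δ none → ≤⇒≯
          (least (s - δ) (λ t t∈ → ≮⇒≥ (λ s-δ<t → none (t , t∈ , s-δ<t , ≤-<-trans (upper t t∈)
            (0<⇒< (solve 2 (λ s d → (s :+ d) :- s := d) refl s δ) 0<δ)))))
          (0<⇒< (solve 2 (λ s d → s :- (s :- d) := d) refl s δ) 0<δ)
      }

  -- Consider the supremum `s` for `A`. If the point at `s` is in `A`, then either s = 1, where `B`
  -- holds as well, or `A` continues past `s`, which is absurd. If it is in `B`, so is a whole
  -- neighbourhood, and `A` comes arbitrarily close to `s`.
  segment-connected : ∀ {d} {A B : Pred (Point ℝ d) 0ℓ} → IsOpen ℝ A → IsOpen ℝ B → ∀ {p q} → A p → B q →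
    (∀ t → 0# ≤ t → t ≤ 1# → ¬ ¬ (A (between p q t) ⊎ B (between p q t))) →
    ¬ ¬ (∃[ t ] 0# ≤ t × t ≤ 1# × A (between p q t) × B (between p q t))
  segment-connected {A = A} {B} open-A open-B {p} {q} p∈A q∈B cover none = at (last open-A q p∈A)
    where
    at : Last A p q → ⊥
    at L = cover s 0≤s s≤1 Sum.[ (λ As → in-A As (s <? 1#) (open-segment open-A p q s As))
                           , (λ Bs → in-B (open-segment open-B p q s Bs)) ]
      where
      open Last L

      overshoot : ∀ {δ θ} → 0# < δ → 0# < θ → θ < δ → θ ≤ 1# - s → ¬ (∀ t → Close ℝ δ s t → A (between p q t))
      overshoot {δ} {θ} 0<δ 0<θ θ<δ θ≤1-s ball = ≤⇒≯ (upper
        ( ≤-trans 0≤s (inj₁ s<s+θ)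
        , 0≤⇒≤ (solve 2 (λ s h → con (+ 1) :- (s :+ h) := (con (+ 1) :- s) :- h) refl s θ) (≤⇒0≤ θ≤1-s)
        , ball (s + θ) ( <-trans (0<⇒< (solve 2 (λ s d → s :- (s :- d) := d) refl s δ) 0<δ) s<s+θ
                       , 0<⇒< (solve 3 (λ s d h → (s :+ d) :- (s :+ h) := d :- h) refl s δ θ) (<⇒0< θ<δ))))
        s<s+θ
        where
        s<s+θ : s < s + θ
        s<s+θ = 0<⇒< (solve 2 (λ s h → (s :+ h) :- s := h) refl s θ) 0<θ

      in-A : A (between p q s) → Dec (s < 1#) → (∃[ δ ] 0# < δ × (∀ t → Close ℝ δ s t → A (between p q t))) → ⊥
      in-A As (no s≮1)  _ = none (s , 0≤s , s≤1 , As , open-resp open-B (≋-sym (between-1 p q (≤∧≮⇒≈ s≤1 s≮1))) q∈B)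
      in-A As (yes s<1) (δ , 0<δ , ball) =
        let η , 0<η , η<δ = shrink 0<δ
            θ , 0<θ , θ≤η , θ≤1-s = meet 0<η (<⇒0< s<1)
        in overshoot 0<δ 0<θ (≤-<-trans θ≤η η<δ) θ≤1-s ball

      in-B : (∃[ δ ] 0# < δ × (∀ t → Close ℝ δ s t → B (between p q t))) → ⊥
      in-B (δ , 0<δ , ball) = approach 0<δ λ (t , (0≤t , t≤1 , At) , c) → none (t , 0≤t , t≤1 , At , ball t c)

  -- Let c be the last point of V₁ on the way from q ∈ V₁ ∩ V₂ ∩ V₃ to the point p₃ of V₃ between p₁ ∈ V₁ and p₂ ∈ V₂.
  -- Moving from a point c′ just before c slightly towards p₁ or p₂ stays in V₁ ∩ V₂ ∩ V₃, hence so does moving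
  -- towards p₃; this leads beyond c.  The set W around p₃ ensures c ≠ p₃.
  module _ {d : ℕ} {V₁ V₂ V₃ W : Pred (Point ℝ d) 0ℓ}
    (open₁ : IsOpen ℝ V₁) (open₃ : IsOpen ℝ V₃) (open-W : IsOpen ℝ W)
    (convex₁ : IsConvex ℝ V₁) (convex₂ : IsConvex ℝ V₂) (convex₃ : IsConvex ℝ V₃)
    (13⇒2 : ∀ {p} → V₁ p → V₃ p → ¬ ¬ V₂ p) (23⇒1 : ∀ {p} → V₂ p → V₃ p → ¬ ¬ V₁ p)
    (13⇒¬W : ∀ {p} → V₁ p → V₃ p → ¬ W p) where

    sunflower-line : ∀ {q p₁ p₂ t₀} → V₁ q → V₃ q → V₁ p₁ → V₂ p₂ → 0# ≤ t₀ → t₀ ≤ 1# →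
      V₃ (between p₁ p₂ t₀) → W (between p₁ p₂ t₀) → ⊥
    sunflower-line {q} {p₁} {p₂} {t₀} q∈V₁ q∈V₃ p₁∈V₁ p₂∈V₂ 0≤t₀ t₀≤1 p₃∈V₃ p₃∈W =
      at (last open₁ (between p₁ p₂ t₀) q∈V₁)
      where
      p₃ : Point ℝ d
      p₃ = between p₁ p₂ t₀

      η : Carrier → Point ℝ d
      η = between q p₃

      η∈V₃ : ∀ {t} → 0# ≤ t → t ≤ 1# → V₃ (η t)
      η∈V₃ = convex₃ q p₃ q∈V₃ p₃∈V₃ _

      at : Last V₁ q p₃ → ⊥
      at L = s<1 conclude
       where
       open Last L

       s<1 : ¬ ¬ (s < 1#)
       s<1 s≮1 = touch (open-segment open-W q p₃ s (open-resp open-W (≋-sym (between-1 q p₃ (≤∧≮⇒≈ s≤1 s≮1))) p₃∈W))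
         where
         touch : (∃[ δ ] 0# < δ × (∀ t → Close ℝ δ s t → W (η t))) → ⊥
         touch (δ , 0<δ , ball) = approach 0<δ λ (t , (0≤t , t≤1 , ηt∈V₁) , c) →
           13⇒¬W ηt∈V₁ (η∈V₃ 0≤t t≤1) (ball t c)

       c : Point ℝ d
       c = η s

     -- For (α , β) = ((1 - λ) (t - s) , λ) this is (1 - λ) η(t) + λ p₂.
       nudge : Point ℝ 2 → Point ℝ d
       nudge τ i = c i + (τ zero * (p₃ i - q i) + τ (suc zero) * (p₂ i - c i))

       cont-nudge : Continuous* nudge
       cont-nudge i = cont-+ (cont-const (c i)) (cont-+ (cont-scale (p₃ i - q i) (cont-proj zero))
                                                        (cont-scale (p₂ i - c i) (cont-proj (suc zero))))

       pair : Carrier → Carrier → Point ℝ 2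
       pair α β zero       = α
       pair α β (suc zero) = β

       nudge-0 : nudge (pair 0# 0#) ≋ c
       nudge-0 i = solve 3 (λ c v w → c :+ (con (+ 0) :* v :+ con (+ 0) :* w) := c) refl (c i) (p₃ i - q i) (p₂ i - c i)

       nudge-between : ∀ t λ′ → nudge (pair ((1# - λ′) * (t - s)) λ′) ≋ between (η t) p₂ λ′
       nudge-between t λ′ i = solve 6 (λ q p₃ p₂ s t l →
         let c = (con (+ 1) :- s) :* q :+ s :* p₃ in
         c :+ (((con (+ 1) :- l) :* (t :- s)) :* (p₃ :- q) :+ l :* (p₂ :- c)) :=
         (con (+ 1) :- l) :* ((con (+ 1) :- t) :* q :+ t :* p₃) :+ l :* p₂) refl
         (q i) (p₃ i) (p₂ i) s t λ′

       -- The homothety with centre `η t` and ratio `λ′` is affine, so it sends p₃, which lies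
       -- between p₁ and p₂, to the corresponding point between their images; that image lies on the
       -- segment from `η t` to p₃.
       towards-p₃ : ∀ t λ′ → between (between (η t) p₁ λ′) (between (η t) p₂ λ′) t₀ ≋ η (t + λ′ * (1# - t))
       towards-p₃ t λ′ i = trans
         (solve 5 (λ c p₁ p₂ l t₀ →
           (con (+ 1) :- t₀) :* ((con (+ 1) :- l) :* c :+ l :* p₁) :+ t₀ :* ((con (+ 1) :- l) :* c :+ l :* p₂) :=
           (con (+ 1) :- l) :* c :+ l :* ((con (+ 1) :- t₀) :* p₁ :+ t₀ :* p₂)) refl (η t i) (p₁ i) (p₂ i) λ′ t₀)
         (solve 4 (λ q p₃ t l →
           (con (+ 1) :- l) :* ((con (+ 1) :- t) :* q :+ t :* p₃) :+ l :* p₃ :=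
           (con (+ 1) :- (t :+ l :* (con (+ 1) :- t))) :* q :+ (t :+ l :* (con (+ 1) :- t)) :* p₃) refl (q i) (p₃ i) t λ′)

       conclude : s < 1# → ⊥
       conclude s<1 = near (open-preimage cont-nudge open₃ (pair 0# 0#) (open-resp open₃ (≋-sym nudge-0) (η∈V₃ 0≤s s≤1)))
         where
         beyond : ∀ {l δ μ t} → l < δ → l < 1# → 0# < l → 0# < δ → (∀ τ → Near ℝ δ (pair 0# 0#) τ → V₃ (nudge τ)) →
           μ ≤ δ → μ ≤ l * (1# - s) → 0# ≤ t → t ≤ 1# → V₁ (η t) → s - μ < t → ⊥
         beyond {l} {δ} {μ} {t} l<δ l<1 0<l 0<δ ball μ≤δ μ≤ 0≤t t≤1 ηt∈V₁ s-μ<t =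
           -- V₁ has to contain both nudged points. The one towards p₁ is in V₁ by convexity; the
           -- one towards p₂ is in V₂ by convexity and in V₃ because V₃ is open around `c`, hence in
           -- V₁. Their combination at `t₀` is then a point of V₁ on the segment with a parameter
           -- above `s`.
           13⇒2 ηt∈V₁ (η∈V₃ 0≤t t≤1) λ ηt∈V₂ →
           23⇒1 (convex₂ (η t) p₂ ηt∈V₂ p₂∈V₂ l (inj₁ 0<l) (inj₁ l<1)) u₂∈V₃ λ u₂∈V₁ →
           ≤⇒≯ (upper
             ( +-nonneg 0≤t (*-nonneg (inj₁ 0<l) (≤⇒0≤ t≤1))
             , 0≤⇒≤ (solve 2 (λ t l → con (+ 1) :- (t :+ l :* (con (+ 1) :- t)) := (con (+ 1) :- l) :* (con (+ 1) :- t)) refl t l)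
                 (*-nonneg (≤⇒0≤ (inj₁ l<1)) (≤⇒0≤ t≤1))
             , open-resp open₁ (towards-p₃ t l)
                 (convex₁ _ _ (convex₁ (η t) p₁ ηt∈V₁ p₁∈V₁ l (inj₁ 0<l) (inj₁ l<1)) u₂∈V₁ t₀ 0≤t₀ t₀≤1)))
             s<t″
           where
           t≤s : t ≤ s
           t≤s = upper (0≤t , t≤1 , ηt∈V₁)

           α : Carrier
           α = (1# - l) * (t - s)

           α-close : Close ℝ δ 0# α
           α-close =
             0<⇒< (solve 5 (λ l d m s t → (con (+ 1) :- l) :* (t :- s) :- (con (+ 0) :- d) :=
                    (t :- (s :- m)) :+ ((d :- m) :+ l :* (s :- t))) refl l δ μ s t)
               (+-pos-nonneg (<⇒0< s-μ<t) (+-nonneg (≤⇒0≤ μ≤δ) (*-nonneg (inj₁ 0<l) (≤⇒0≤ t≤s)))) ,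
             0<⇒< (solve 4 (λ l d s t → (con (+ 0) :+ d) :- (con (+ 1) :- l) :* (t :- s) :=
                    d :+ (con (+ 1) :- l) :* (s :- t)) refl l δ s t)
               (+-pos-nonneg 0<δ (*-nonneg (≤⇒0≤ (inj₁ l<1)) (≤⇒0≤ t≤s)))

           l-close : Close ℝ δ 0# l
           l-close = 0<⇒< (solve 2 (λ l d → l :- (con (+ 0) :- d) := l :+ d) refl l δ) (+-pos 0<l 0<δ)
                   , 0<⇒< (solve 2 (λ l d → (con (+ 0) :+ d) :- l := d :- l) refl l δ) (<⇒0< l<δ)

           u₂∈V₃ : V₃ (between (η t) p₂ l)
           u₂∈V₃ = open-resp open₃ (nudge-between t l)
             (ball (pair α l) (λ { zero → α-close ; (suc zero) → l-close }))

           s<t″ : s < t + l * (1# - t)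
           s<t″ = 0<⇒< (solve 4 (λ s t l m → (t :+ l :* (con (+ 1) :- t)) :- s :=
               (t :- (s :- m)) :+ ((l :* (con (+ 1) :- s) :- m) :+ l :* (s :- t))) refl s t l μ)
             (+-pos-nonneg (<⇒0< s-μ<t) (+-nonneg (≤⇒0≤ μ≤) (*-nonneg (inj₁ 0<l) (≤⇒0≤ t≤s))))

         near : (∃[ δ ] 0# < δ × (∀ τ → Near ℝ δ (pair 0# 0#) τ → V₃ (nudge τ))) → ⊥
         near (δ , 0<δ , ball) =
           let δ′ , 0<δ′ , δ′≤δ , δ′≤1 = meet 0<δ 0<1
               l , 0<l , l<δ′ = shrink 0<δ′
               -- The bound by `δ` keeps `α` within `δ` of 0. The bound by l (1 - s) makes the
               -- advance l (1 - t) exceed the gap s - t, which is below `μ`.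
               μ , 0<μ , μ≤δ , μ≤l[1-s] = meet 0<δ (*-pos 0<l (<⇒0< s<1))
           in approach 0<μ λ (t , (0≤t , t≤1 , ηt∈V₁) , s-μ<t , _) →
              beyond (<-≤-trans l<δ′ δ′≤δ) (<-≤-trans l<δ′ δ′≤1) 0<l 0<δ ball μ≤δ μ≤l[1-s] 0≤t t≤1 ηt∈V₁ s-μ<t

  C₀-nonconvex : ¬ ConvexCode ℝ C₀
  C₀-nonconvex (d , X , U , open-X , convex-X , u , C₀⊆code , code⊆C₀) =
    let q  , _ , q∈  , _ = C₀⊆code 123∈C₀
        p₁ , _ , p₁∈ , _ = C₀⊆code 145∈C₀
        p₂ , _ , p₂∈ , _ = C₀⊆code 256∈C₀
        q∈₁ = q∈ 𝟏 (toWitness {a? = 𝟏 ∈? _} _)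
        q∈₃ = q∈ 𝟑 (toWitness {a? = 𝟑 ∈? _} _)
        p₁∈₁ = p₁∈ 𝟏 (toWitness {a? = 𝟏 ∈? _} _)
        p₁∈₄ = p₁∈ 𝟒 (toWitness {a? = 𝟒 ∈? _} _)
        p₁∈₅ = p₁∈ 𝟓 (toWitness {a? = 𝟓 ∈? _} _)
        p₂∈₂ = p₂∈ 𝟐 (toWitness {a? = 𝟐 ∈? _} _)
        p₂∈₅ = p₂∈ 𝟓 (toWitness {a? = 𝟓 ∈? _} _)
        p₂∈₆ = p₂∈ 𝟔 (toWitness {a? = 𝟔 ∈? _} _)
        on-5 = λ t 0≤t t≤1 → isConvex 𝟓 p₁ p₂ p₁∈₅ p₂∈₅ t 0≤t t≤1
    in segment-connected (isOpen 𝟒) (isOpen 𝟔) p₁∈₄ p₂∈₆ (λ t 0≤t t≤1 → 5⇒46 (on-5 t 0≤t t≤1))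
       λ (t₀ , 0≤t₀ , t₀≤1 , ∈₄ , ∈₆) → 46⇒3 ∈₄ ∈₆ λ ∈₃ →
       sunflower-line (isOpen 𝟏) (isOpen 𝟑) (isOpen 𝟓) (isConvex 𝟏) (isConvex 𝟐) (isConvex 𝟑) 13⇒2 23⇒1 13⇒¬5
         q∈₁ q∈₃ p₁∈₁ p₂∈₂ 0≤t₀ t₀≤1 ∈₃ (on-5 t₀ 0≤t₀ t₀≤1)
    where
    isOpen : ∀ i → IsOpen ℝ (U i)
    isOpen i = proj₁ (u i)

    isConvex : ∀ i → IsConvex ℝ (U i)
    isConvex i = proj₁ (proj₂ (u i))

    -- Excluded middle for the six statements `U j p` holds under double negation, which turns the
    -- indices of the sets containing `p` into a codeword. Membership in one `U i` places `p` in
    -- `X`, as `code` requires.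
    cell : ∀ {p i} → U i p → ¬ ¬ (∃[ c ] Relations c × (∀ j → U j p → j Sub.∈ c) × (∀ j → j Sub.∈ c → U j p))
    cell {p} {i} p∈Ui k = ¬¬-∀ {P = λ j → Dec (U j p)} (λ j → ¬¬-excluded-middle) λ U? →
      k ( Vec.tabulate (does ∘ U?)
        , relations _ (code⊆C₀ (p , proj₂ (proj₂ (u i)) p∈Ui , (λ j → ∈-tabulate⁻ U?) , λ j j∉ Ujp → j∉ (∈-tabulate⁺ U? Ujp)))
        , (λ j → ∈-tabulate⁺ U?) , (λ j → ∈-tabulate⁻ U?))

    5⇒46 : ∀ {p} → U 𝟓 p → ¬ ¬ (U 𝟒 p ⊎ U 𝟔 p)
    5⇒46 p∈₅ k = cell p∈₅ λ (c , (r , _) , ∈c , c∈) → k (Sum.map (c∈ 𝟒) (c∈ 𝟔) (r (∈c 𝟓 p∈₅)))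

    46⇒3 : ∀ {p} → U 𝟒 p → U 𝟔 p → ¬ ¬ U 𝟑 p
    46⇒3 p∈₄ p∈₆ k = cell p∈₄ λ (c , (_ , r , _) , ∈c , c∈) → k (c∈ 𝟑 (r (∈c 𝟒 p∈₄) (∈c 𝟔 p∈₆)))

    13⇒2 : ∀ {p} → U 𝟏 p → U 𝟑 p → ¬ ¬ U 𝟐 p
    13⇒2 p∈₁ p∈₃ k = cell p∈₁ λ (c , (_ , _ , r , _) , ∈c , c∈) → k (c∈ 𝟐 (r (∈c 𝟏 p∈₁) (∈c 𝟑 p∈₃)))

    23⇒1 : ∀ {p} → U 𝟐 p → U 𝟑 p → ¬ ¬ U 𝟏 p
    23⇒1 p∈₂ p∈₃ k = cell p∈₂ λ (c , (_ , _ , _ , r , _) , ∈c , c∈) → k (c∈ 𝟏 (r (∈c 𝟐 p∈₂) (∈c 𝟑 p∈₃)))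

    13⇒¬5 : ∀ {p} → U 𝟏 p → U 𝟑 p → ¬ U 𝟓 p
    13⇒¬5 p∈₁ p∈₃ p∈₅ = cell p∈₁ λ (c , (_ , _ , _ , _ , r) , ∈c , c∈) → r (∈c 𝟏 p∈₁) (∈c 𝟑 p∈₃) (∈c 𝟓 p∈₅)

  -- Realizations

  literal : Bool → Carrier → Carrier
  literal s x = if s then x else - x

  form : ∀ {k} → Clause k → Point ℝ k → Carrier
  form (s , S) p = sum (λ j → if lookup S j then literal s (p j) else 0#)

  cont-form : ∀ {k} (c : Clause k) → Continuous (form c)
  cont-form (s , S) = cont-sum (λ j → term s (lookup S j) j)
    where
    term : ∀ s b j → Continuous (λ p → if b then literal s (p j) else 0#)
    term true  true  j = cont-proj j
    term false true  j = cont-neg (cont-proj j)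
    term s     false j = cont-const 0#

  affine-form : ∀ {k} (c : Clause k) → Affine (form c)
  affine-form (s , S) = affine-sum (λ j → term s (lookup S j) j)
    where
    term : ∀ s b j → Affine (λ p → if b then literal s (p j) else 0#)
    term true  true  j p q t = refl
    term false true  j p q t = solve 3 (λ t x y → :- ((con (+ 1) :- t) :* x :+ t :* y) :=
      (con (+ 1) :- t) :* :- x :+ t :* :- y) refl t (p j) (q j)
    term s     false j p q t = solve 1 (λ t → con (+ 0) := (con (+ 1) :- t) :* con (+ 0) :+ t :* con (+ 0)) refl t

  +-nonpos : ∀ {x y} → x ≤ 0# → y ≤ 0# → x + y ≤ 0#
  +-nonpos {x} {y} x≤0 y≤0 = 0≤⇒≤
    (solve 2 (λ x y → con (+ 0) :- (x :+ y) := (con (+ 0) :- x) :+ (con (+ 0) :- y)) refl x y)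
    (+-nonneg (≤⇒0≤ x≤0) (≤⇒0≤ y≤0))

  sum-nonpos : ∀ {n} {h : Fin n → Carrier} → (∀ i → h i ≤ 0#) → sum h ≤ 0#
  sum-nonpos {zero}  h≤0 = ≤-refl
  sum-nonpos {suc n} h≤0 = +-nonpos (h≤0 zero) (sum-nonpos (h≤0 ∘ suc))

  sum-positive : ∀ {n} {h : Fin n → Carrier} → 0# < sum h → ∃[ i ] 0# < h i
  sum-positive {n} {h} 0<h = decidable-stable (Fin.any? (λ i → 0# <? h i)) λ none →
    ≤⇒≯ (sum-nonpos (λ i → ≮⇒≥ (λ 0<hi → none (i , 0<hi)))) 0<h

  fromℕ-positive : ∀ n → 0# < fromℤ (+ suc n)
  fromℕ-positive zero    = 0<1
  fromℕ-positive (suc n) = +-pos (fromℕ-positive n) 0<1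

  fromℤ-positive : ∀ {i} → + 0 ℤ.< i → 0# < fromℤ i
  fromℤ-positive {+ suc n} _ = fromℕ-positive n
  fromℤ-positive {+ zero} (ℤ.+<+ ())

  fromℤ-nonpositive : ∀ {i} → ¬ + 0 ℤ.< i → ¬ 0# < fromℤ i
  fromℤ-nonpositive {+ zero}   _ 0<i = <-irrefl refl 0<i
  fromℤ-nonpositive {+ suc n}  i≤0 _ = i≤0 (ℤ.+<+ (ℕ.s≤s ℕ.z≤n))
  fromℤ-nonpositive { -[1+ n ]} _ 0<i = <-irrefl (sym (-‿inverseʳ _)) (+-pos (fromℕ-positive n) 0<i)

  fromℤ-sum : ∀ {n} (h : Fin n → ℤ) → fromℤ (Functional.foldr ℤ._+_ (+ 0) h) ≈ sum (fromℤ ∘ h)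
  fromℤ-sum {zero}  h = refl
  fromℤ-sum {suc n} h = trans (fromℤ-+ (h zero) _) (+-congˡ (fromℤ-sum (h ∘ suc)))

  positives : ∀ {k} → Point ℝ k → Subset k
  positives p = Vec.tabulate (λ j → does (0# <? p j))

  module _ (χ : Chart) (word-C₀ : WordsInC₀ χ) (realized : Realized χ) (onto : Onto χ) where
    open Chart χ

    Feasible : Pred (Point ℝ dim) 0ℓ
    Feasible p = All (λ c → 0# < form c p) clauses

    feasible⇒model : ∀ {p} → Feasible p → Model clauses (positives p)
    feasible⇒model {p} = All.map (satisfied _)
      where
      sat : ∀ s S j → 0# < (if lookup S j then literal s (p j) else 0#) → lookup S j ≡ true × lookup (positives p) j ≡ s
      sat s S j 0<l with lookup S j
      sat true  S j 0<l | true  = ≡.refl , Vec.[]=⇒lookup (∈-tabulate⁺ (λ j → 0# <? p j) 0<l)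
      sat false S j 0<l | true  = ≡.refl , ≡.trans (Vec.lookup∘tabulate _ j) (dec-false (0# <? p j)
        (λ 0<pj → <-irrefl (sym (-‿inverseʳ _)) (+-pos 0<pj 0<l)))
      sat s S j 0<0 | false = ⊥-elim (<-irrefl refl 0<0)

      satisfied : ∀ c → 0# < form c p → Satisfies (positives p) c
      satisfied (s , S) 0<f =
        let j , 0<l = sum-positive 0<f
            Sj , pj = sat s S j 0<l
        in j , Vec.lookup⇒[]= j S Sj , pj

    realize : ∀ {c} → C₀ c → ∃[ p ] Feasible p × word (positives p) ≡ c
    realize {c} c∈ =
      let b , bm , wb≡c = onto c c∈
          signs , forms = realized b bm
          p = fromℤ ∘ lookup (point b)
      in p , All.map (λ {c} 0<f → <-respʳ (form≈ c (point b)) (fromℤ-positive 0<f)) forms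
           , ≡.trans (≡.cong word (≡.sym (subset-ext
               (λ j j∈b → ∈-tabulate⁺ (λ j → 0# <? p j) (fromℤ-positive (proj₁ (signs j) j∈b)))
               (λ j j∉b j∈p → fromℤ-nonpositive (proj₂ (signs j) j∉b) (∈-tabulate⁻ (λ j → 0# <? p j) j∈p))))) wb≡c
      where
      term : ∀ b s i → fromℤ (if b then (if s then i else ℤ.- i) else + 0) ≈ (if b then literal s (fromℤ i) else 0#)
      term true  true  i = refl
      term true  false i = fromℤ-neg i
      term false s     i = refl

      form≈ : ∀ c z → fromℤ (formℤ χ c z) ≈ form c (fromℤ ∘ lookup z)
      form≈ (s , S) z = trans (fromℤ-sum {dim} _) (sum-cong-≋ (λ j → term (lookup S j) s (lookup z j)))

    Region : Code 6 → Pred (Point ℝ dim) 0ℓ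
    Region T p = Feasible p × T (word (positives p))

    Nice : Code 6 → Set
    Nice T = IsOpen ℝ (Region T) × IsConvex ℝ (Region T)

    nice-≐ : ∀ {T T′} → T ≐ T′ → Nice T → Nice T′
    nice-≐ (T⊆T′ , T′⊆T) (oT , cT) =
      open-≐ ((λ (f , t) → f , T⊆T′ t) , (λ (f , t) → f , T′⊆T t)) oT ,
      λ p q (fp , tp) (fq , tq) t 0≤t t≤1 →
        let f , t = cT p q (fp , T′⊆T tp) (fq , T′⊆T tq) t 0≤t t≤1 in f , T⊆T′ t

    nice-empty : ∀ {T} → Empty T → Nice T
    nice-empty empty = (λ _ (_ , t) → ⊥-elim (empty _ t)) , λ _ _ (_ , t) → ⊥-elim (empty _ t)

    nice-cutOut : ∀ {σ} → CutOut χ σ → Nice (Tk C₀ σ)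
    nice-cutOut (inj₁ never) =
      (λ p (f , _ , σ⊆) → ⊥-elim (never _ (feasible⇒model f) σ⊆)) ,
      λ p _ (f , _ , σ⊆) → ⊥-elim (never _ (feasible⇒model f) σ⊆)
    nice-cutOut {σ} (inj₂ (S , equiv)) =
      open-≐ (cut⇒trunk , trunk⇒cut)
        (open-∩ (open-All (λ c → open-positive (cont-form c)) clauses)
                (open-∀ (λ j → open-⇒ (j ∈? S) (open-positive (cont-proj j))))) ,
      λ p q p∈ q∈ t 0≤t t≤1 →
        let fp , cp = trunk⇒cut p∈
            fq , cq = trunk⇒cut q∈
        in cut⇒trunk
          ( convex-All (λ c → convex-positive (affine-form c)) clauses p q fp fq t 0≤t t≤1
          , λ j j∈S → convex-positive {g = λ p → p j} (λ _ _ _ → refl) p q (cp j j∈S) (cq j j∈S) t 0≤t t≤1)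
      where
      Cut : Pred (Point ℝ dim) 0ℓ
      Cut p = ∀ j → j Sub.∈ S → 0# < p j

      cut⇒trunk : Feasible ∩ Cut ⊆ₚ Region (Tk C₀ σ)
      cut⇒trunk {p} (f , cut) = f , word-C₀ _ (feasible⇒model f) ,
        proj₁ (equiv _ (feasible⇒model f)) (λ {j} j∈S → ∈-tabulate⁺ (λ j → 0# <? p j) (cut j j∈S))

      trunk⇒cut : Region (Tk C₀ σ) ⊆ₚ Feasible ∩ Cut
      trunk⇒cut {p} (f , _ , σ⊆) = f , λ j j∈S →
        ∈-tabulate⁻ (λ j → 0# <? p j) (proj₂ (equiv _ (feasible⇒model f)) σ⊆ j∈S)

    -- One construction covers trunks, where `w` is the identity, and images, where `T` is `C₀` and
    -- `w` is the morphism. Since `w` takes the membership proof irrelevantly, a point has the same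
    -- new label for all proofs, which is what `readOff` relies on.
    relabel-convex : ∀ {m} (T : Code 6) → T ⊆ₚ C₀ → Nice T → (w : ∀ c → .(T c) → Subset m) →
      (∀ j → Nice (λ c → Σ[ t ∈ T c ] j Sub.∈ w c t)) →
      ConvexCode ℝ (λ d → ∃[ c ] Σ[ t ∈ T c ] w c t ≡ d)
    relabel-convex T T⊆C₀ (oT , cT) w nice =
      dim , Region T , (λ j → Region (λ c → Σ[ t ∈ T c ] j Sub.∈ w c t)) , oT , cT ,
      (λ j → proj₁ (nice j) , proj₂ (nice j) , λ (f , t , _) → f , t) ,
      realizable , readOff
      where
      realizable : ∀ {d} → (∃[ c ] Σ[ t ∈ T c ] w c t ≡ d) → code ℝ _ (Region T) d
      realizable (c , t , ≡.refl) with realize (T⊆C₀ t)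
      ... | p , f , ≡.refl = p , (f , t) , (λ j j∈ → f , t , j∈) , λ j j∉ (_ , _ , j∈) → j∉ j∈

      readOff : ∀ {d} → code ℝ _ (Region T) d → ∃[ c ] Σ[ t ∈ T c ] w c t ≡ d
      readOff (p , (f , t) , ins , outs) = _ , t , ≡.sym (subset-ext
        (λ j j∈ → proj₂ (proj₂ (ins j j∈))) (λ j j∉ j∈ → outs j j∉ (f , t , j∈)))

  -- Convexity of the proper trunks of C₀

  module _ (i : Fin 6) where

    NiceOff : Code 6 → Set
    NiceOff = Nice (chart i) (chart-wordsInC₀ i) (chart-realized i) (chart-onto i)

    niceOff-Tk : ∀ σ → ¬ (Finer σ ⁅ i ⁆ × Finer ⁅ i ⁆ σ) → NiceOff (Tk C₀ σ)
    niceOff-Tk σ differ with chart-cutOut i σ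
    ... | inj₁ same = ⊥-elim (differ same)
    ... | inj₂ cut  = nice-cutOut (chart i) (chart-wordsInC₀ i) (chart-realized i) (chart-onto i) cut

    relabelOff-convex : ∀ {m} (T : Code 6) → T ⊆ₚ C₀ → NiceOff T → (w : ∀ c → .(T c) → Subset m) →
      (∀ j → NiceOff (λ c → Σ[ t ∈ T c ] j Sub.∈ w c t)) →
      ConvexCode ℝ (λ d → ∃[ c ] Σ[ t ∈ T c ] w c t ≡ d)
    relabelOff-convex = relabel-convex (chart i) (chart-wordsInC₀ i) (chart-realized i) (chart-onto i)

    niceOff-≐ : ∀ {T T′} → T ≐ T′ → NiceOff T → NiceOff T′
    niceOff-≐ = nice-≐ (chart i) (chart-wordsInC₀ i) (chart-realized i) (chart-onto i)

    niceOff-empty : ∀ {T} → Empty T → NiceOff T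
    niceOff-empty = nice-empty (chart i) (chart-wordsInC₀ i) (chart-realized i) (chart-onto i)

  convexCode-≐ : ∀ {n} {C D : Code n} → C ≐ D → ConvexCode ℝ C → ConvexCode ℝ D
  convexCode-≐ (C⊆D , D⊆C) (d , X , U , oX , cX , u , (C⊆ , ⊆C)) =
    d , X , U , oX , cX , u , (λ σ∈D → C⊆ (D⊆C σ∈D)) , (λ σ∈ → C⊆D (⊆C σ∈))

  trunk-convex : ∀ T → IsTrunk C₀ T → T ⊂ C₀ → ConvexCode ℝ T
  trunk-convex T trunk (T⊆C₀ , C₀⊈T) =
    let i , nice = avoid trunk in
    convexCode-≐ ((λ { (c , t , ≡.refl) → t }) , (λ t → _ , t , ≡.refl))
      (relabelOff-convex i T T⊆C₀ (niceOff-≐ i {λ c → T c × Sub.⊥ Sub.⊆ c} {T} (proj₁ , (λ t → t , Sub.⊥⊆)) (nice Sub.⊥)) (λ c _ → c)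
        (λ j → niceOff-≐ i {λ c → T c × ⁅ j ⁆ Sub.⊆ c} {λ c → Σ[ t ∈ T c ] j Sub.∈ c} ((λ (t , j⊆) → t , j⊆ (x∈⁅x⁆ j)) , (λ (t , j∈) → t , ⁅⁆⊆ j∈)) (nice ⁅ j ⁆)))
    where
    avoid : IsTrunk C₀ T → ∃[ i ] (∀ τ → NiceOff i (λ c → T c × τ Sub.⊆ c))
    avoid (inj₁ empty) = zero , λ τ → niceOff-empty zero {λ c → T c × τ Sub.⊆ c} (λ c (t , _) → empty c t)
    avoid (inj₂ (σ , T⊆Tk , Tk⊆T)) with trunk-avoids σ
    ... | inj₁ all = ⊥-elim (C₀⊈T (λ {c} c∈ → Tk⊆T (c∈ , all c c∈ Sub.⊥⊆)))
    ... | inj₂ (i , i⊈σ) = i , λ τ → niceOff-≐ i {Tk C₀ (σ Sub.∪ τ)} {λ c → T c × τ Sub.⊆ c}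
      ( (λ (c∈ , στ⊆c) → Tk⊆T (c∈ , στ⊆c ∘ Sub.p⊆p∪q τ) , στ⊆c ∘ Sub.q⊆p∪q σ τ)
      , (λ (t , τ⊆c) → let c∈ , σ⊆c = T⊆Tk t in c∈ , λ j∈ → Sum.[ σ⊆c , τ⊆c ] (Sub.x∈p∪q⁻ σ τ j∈)))
      (niceOff-Tk i (σ Sub.∪ τ) λ (_ , i⊆στ) → i⊈σ (λ c c∈ i⊆c → i⊆στ c c∈ i⊆c ∘ Sub.p⊆p∪q τ))

  -- Images of C₀ under morphisms

  niceOff-trunk : ∀ i {Q} (trunk : IsTrunk C₀ Q) → ¬ Hits trunk i → NiceOff i Q
  niceOff-trunk i {Q} (inj₁ empty)           _    = niceOff-empty i {Q} empty
  niceOff-trunk i {Q} (inj₂ (σ , Q⊆Tk , Tk⊆Q)) miss = niceOff-≐ i {Tk C₀ σ} {Q} (Tk⊆Q , Q⊆Tk) (niceOff-Tk i σ miss)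

  module _ {m : ℕ} (D : Code m) (f : Codeword C₀ → Codeword D) (mor : IsMorphism {C = C₀} {D} f) where

    private
      P : Code m → Code 6
      P = preimage {C = C₀} {D} f

      E : Code m
      E = image {C = C₀} {D} f

      w : ∀ c → .(C₀ c) → Subset m
      w c c∈ = value (f (c , [ c∈ ]))

    trunk-Tk : ∀ τ → IsTrunk C₀ (P (Tk D τ))
    trunk-Tk τ = mor (Tk D τ) (inj₂ (τ , id , id))

    ⊆⇒preimage : ∀ τ {c} (c∈ : C₀ c) → τ Sub.⊆ w c c∈ → P (Tk D τ) c
    ⊆⇒preimage τ {c} c∈ τ⊆w = recover (trunk-Tk τ) c∈
      (Irrelevant.map (λ d∈ → c∈ , d∈ , τ⊆w) (Refinement.proof (f (c , [ c∈ ]))))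

    preimage-⁅⁆ : ∀ j → P (Tk D ⁅ j ⁆) ≐ (λ c → Σ[ c∈ ∈ C₀ c ] j Sub.∈ w c c∈)
    preimage-⁅⁆ j = (λ (c∈ , _ , j⊆) → c∈ , j⊆ (x∈⁅x⁆ j)) , λ (c∈ , j∈) → ⊆⇒preimage ⁅ j ⁆ c∈ (⁅⁆⊆ j∈)

    missing⇒convex : ∀ i → (∀ j → ¬ Hits (trunk-Tk ⁅ j ⁆) i) → ConvexCode ℝ E
    missing⇒convex i miss = relabelOff-convex i C₀ id
      -- The ambient set must be convex too: it is labelled by the trunk of the empty set, which
      -- differs from every `Tk C₀ ⁅ i ⁆`.
      (niceOff-≐ i {Tk C₀ Sub.⊥} {C₀} (proj₁ , (λ c∈ → c∈ , Sub.⊥⊆)) (niceOff-Tk i Sub.⊥ (finer-⊥ i ∘ proj₁))) w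
      (λ j → niceOff-≐ i {P (Tk D ⁅ j ⁆)} {λ c → Σ[ c∈ ∈ C₀ c ] j Sub.∈ w c c∈} (preimage-⁅⁆ j) (niceOff-trunk i (trunk-Tk ⁅ j ⁆) (miss j)))

    module _ (hit : ∀ i → ∃[ j ] Hits (trunk-Tk ⁅ j ⁆) i) where

      private
        index : Fin 6 → Fin m
        index i = proj₁ (hit i)

        -- A left inverse of the morphism: coordinate `index i` of the image of c records whether i
        -- belongs to c.
        restrict : Subset m → Subset 6
        restrict d = Vec.tabulate (λ i → does (index i ∈? d))

        indices? : ∀ (σ : Subset 6) k → Dec (∃[ i ] i Sub.∈ σ × index i ≡ k)
        indices? σ k = Fin.any? (λ i → (i ∈? σ) ×-dec (index i Fin.≟ k))

        -- The image of σ under `index`; its trunk in `E` is the preimage of `Tk C₀ σ` under `to`.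
        indices : Subset 6 → Subset m
        indices σ = Vec.tabulate (does ∘ indices? σ)

        ∈-restrict⁺ : ∀ {d i} → index i Sub.∈ d → i Sub.∈ restrict d
        ∈-restrict⁺ {d} = ∈-tabulate⁺ (λ i → index i ∈? d)

        ∈-restrict⁻ : ∀ {d i} → i Sub.∈ restrict d → index i Sub.∈ d
        ∈-restrict⁻ {d} = ∈-tabulate⁻ (λ i → index i ∈? d)

        restrict-w : ∀ c (c∈ : C₀ c) → restrict (w c c∈) ≡ c
        restrict-w c c∈ = Sub.⊆-antisym
          (λ {i} i∈ → hits⇒∈ (trunk-Tk ⁅ index i ⁆) (proj₂ (hit i))
            (proj₂ (preimage-⁅⁆ (index i)) (c∈ , ∈-restrict⁻ i∈)))
          (λ {i} i∈ → ∈-restrict⁺ (proj₂ (proj₁ (preimage-⁅⁆ (index i))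
            (∈⇒hits (trunk-Tk ⁅ index i ⁆) (proj₂ (hit i)) c∈ i∈))))

        restrict-C₀ : ∀ d → E d → C₀ (restrict d)
        restrict-C₀ d (c , c∈ , w≡d) = ≡.subst C₀ (≡.trans (≡.sym (restrict-w c c∈)) (≡.cong restrict w≡d)) c∈

        w-restrict : ∀ d (d∈ : E d) → w (restrict d) (restrict-C₀ d d∈) ≡ d
        w-restrict d (c , c∈ , ≡.refl) = same (restrict-w c c∈) _ c∈
          where
          same : ∀ {c c′} → c ≡ c′ → .(c∈ : C₀ c) .(c′∈ : C₀ c′) → w c c∈ ≡ w c′ c′∈
          same ≡.refl _ _ = ≡.refl

        codeword-≡ : ∀ {n} {C : Code n} {x y : Codeword C} → value x ≡ value y → x ≡ y
        codeword-≡ ≡.refl = ≡.refl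

        to : Codeword E → Codeword C₀
        to (d , [ d∈ ]) = restrict d , [ restrict-C₀ d d∈ ]

        from : Codeword C₀ → Codeword E
        from (c , [ c∈ ]) = w c c∈ , [ (c , c∈ , ≡.refl) ]

        bijection : Codeword E ↔ Codeword C₀
        bijection = mk↔ₛ′ to from
          (λ (c , [ c∈ ]) → codeword-≡ {C = C₀} (recompute (_ ≟ₛ _) (restrict-w c c∈)))
          (λ (d , [ d∈ ]) → codeword-≡ {C = E} (recompute (_ ≟ₛ _) (w-restrict d d∈)))

        to-morphism : IsMorphism {C = E} {C₀} to
        to-morphism T (inj₁ empty)             = inj₁ (λ d (_ , t) → empty _ t)
        to-morphism T (inj₂ (σ , T⊆Tk , Tk⊆T)) = inj₂ (indices σ
          , (λ (d∈ , t) → d∈ , λ k∈ → let i , i∈σ , i≡k = ∈-tabulate⁻ (indices? σ) k∈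
                                      in ≡.subst (Sub._∈ _) i≡k (∈-restrict⁻ (proj₂ (T⊆Tk t) i∈σ)))
          , (λ (d∈ , ι⊆d) → d∈ , Tk⊆T (restrict-C₀ _ d∈ ,
               λ i∈σ → ∈-restrict⁺ (ι⊆d (∈-tabulate⁺ (indices? σ) (_ , i∈σ , ≡.refl))))))

        from-morphism : IsMorphism {C = C₀} {E} from
        from-morphism T (inj₁ empty)             = inj₁ (λ c (_ , t) → empty _ t)
        from-morphism T (inj₂ (τ , T⊆Tk , Tk⊆T)) = pull (trunk-Tk τ)
          where
          Q : Code 6
          Q = preimage {C = C₀} {E} from T

          Q≐P : Q ≐ P (Tk D τ)
          Q≐P = (λ (c∈ , t) → ⊆⇒preimage τ c∈ (proj₂ (T⊆Tk t)))
              , (λ (c∈ , _ , τ⊆w) → c∈ , Tk⊆T ((_ , c∈ , ≡.refl) , τ⊆w))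

          pull : IsTrunk C₀ (P (Tk D τ)) → IsTrunk C₀ Q
          pull (inj₁ empty)             = inj₁ (λ c q → empty c (proj₁ Q≐P q))
          pull (inj₂ (σ , P⊆Tk , Tk⊆P)) = inj₂ (σ , P⊆Tk ∘ proj₁ Q≐P , proj₂ Q≐P ∘ Tk⊆P)

      hit⇒isomorphic : Isomorphic E C₀
      hit⇒isomorphic = bijection , to-morphism , from-morphism

    image-convex : ¬ Isomorphic E C₀ → ConvexCode ℝ E
    image-convex E≇C₀ = decide (Fin.all? hit?)
      where
      hit? : ∀ i → Dec (∃[ j ] Hits (trunk-Tk ⁅ j ⁆) i)
      hit? i = Fin.any? (λ j → hits? (trunk-Tk ⁅ j ⁆) i)

      decide : Dec (∀ i → ∃[ j ] Hits (trunk-Tk ⁅ j ⁆) i) → ConvexCode ℝ E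
      decide (yes hit) = ⊥-elim (E≇C₀ (hit⇒isomorphic hit))
      decide (no ¬hit) = let i , miss = Fin.¬∀⟶∃¬ 6 _ hit? ¬hit in missing⇒convex i (λ j h → miss (j , h))

  -- Contractions

  single : ∀ {n} → Fin n → Carrier → Point ℝ n
  single a w i = if does (i Fin.≟ a) then w else 0#

  single-self : ∀ {n} (a : Fin n) w → single a w a ≈ w
  single-self a w rewrite dec-true (a Fin.≟ a) ≡.refl = refl

  single-other : ∀ {n} (a i : Fin n) w → i ≢ a → single a w i ≈ 0#
  single-other a i w i≢a rewrite dec-false (i Fin.≟ a) i≢a = refl

  single-≤ : ∀ {n} (a : Fin n) {w} → 0# ≤ w → ∀ i → 0# ≤ single a w i
  single-≤ a 0≤w i with does (i Fin.≟ a)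
  ... | true  = 0≤w
  ... | false = ≤-refl

  single-0 : ∀ {n} (a : Fin n) {w} → w ≈ 0# → ∀ i → single a w i ≈ 0#
  single-0 a w≈0 i with does (i Fin.≟ a)
  ... | true  = w≈0
  ... | false = refl

  sum-single : ∀ {n} (a : Fin n) w → sum (single a w) ≈ w
  sum-single {suc n} zero    w = trans (+-congˡ (sum-replicate-zero n)) (+-identityʳ w)
  sum-single {suc n} (suc a) w = trans (+-identityˡ _) (sum-single a w)

  cont-single : ∀ {k n} (a : Fin n) {w : Point ℝ k → Carrier} → Continuous w → Continuous* (λ p → single a (w p))
  cont-single a cw i with does (i Fin.≟ a)
  ... | true  = cw
  ... | false = cont-const 0#

  sum-nonneg : ∀ {n} {x : Point ℝ n} → (∀ i → 0# ≤ x i) → 0# ≤ sum x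
  sum-nonneg {zero}  0≤x = ≤-refl
  sum-nonneg {suc n} 0≤x = +-nonneg (0≤x zero) (sum-nonneg (0≤x ∘ suc))

  term≤sum : ∀ {n} {x : Point ℝ n} → (∀ i → 0# ≤ x i) → ∀ i → x i ≤ sum x
  term≤sum {suc n} {x} 0≤x zero = 0≤⇒≤
    (solve 2 (λ a s → (a :+ s) :- a := s) refl (x zero) (sum (x ∘ suc))) (sum-nonneg (0≤x ∘ suc))
  term≤sum {suc n} {x} 0≤x (suc i) = ≤-trans (term≤sum (0≤x ∘ suc) i) (0≤⇒≤
    (solve 2 (λ a s → (a :+ s) :- s := a) refl (x zero) (sum (x ∘ suc))) (0≤x zero))

  -- The mass min(t, x v) moves from v to a.
  module Transfer {n : ℕ} (v a : Fin n) where

    moved : Carrier → Point ℝ n → Carrier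
    moved t x = x v - (x v - t) ⁺

    transfer : Carrier → Point ℝ n → Point ℝ n
    transfer t x i = x i + (single a (moved t x) i - single v (moved t x) i)

    cont-transfer : ∀ {k} {t : Point ℝ k → Carrier} {x : Point ℝ k → Point ℝ n} →
                    Continuous t → Continuous* x → Continuous* (λ p → transfer (t p) (x p))
    cont-transfer {t = t} {x} ct cx i = cont-+ (cx i) (cont-+ (cont-single a cm i) (cont-neg (cont-single v cm i)))
      where
      cm : Continuous (λ p → moved (t p) (x p))
      cm = cont-+ (cx v) (cont-neg (cont-⁺ (cont-+ (cx v) (cont-neg ct))))

    sum-transfer : ∀ t x → sum (transfer t x) ≈ sum x
    sum-transfer t x = begin
      sum y                                            ≈⟨ solve 2 (λ s w → s := (s :+ w) :- w) refl (sum y) w ⟩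
      (sum y + w) - w                                  ≈⟨ +-congʳ (+-congˡ (sum-single v w)) ⟨
      (sum y + sum (single v w)) - w                   ≈⟨ +-congʳ (∑-distrib-+ y (single v w)) ⟨
      sum (λ i → y i + single v w i) - w               ≈⟨ +-congʳ (sum-cong-≋ (λ i →
        solve 3 (λ x p q → (x :+ (p :- q)) :+ q := x :+ p) refl (x i) (single a w i) (single v w i))) ⟩
      sum (λ i → x i + single a w i) - w               ≈⟨ +-congʳ (∑-distrib-+ x (single a w)) ⟩
      (sum x + sum (single a w)) - w                   ≈⟨ +-congʳ (+-congˡ (sum-single a w)) ⟩
      (sum x + w) - w                                  ≈⟨ solve 2 (λ s w → (s :+ w) :- w := s) refl (sum x) w ⟩
      sum x                                            ∎
      where
      w = moved t x
      y = transfer t x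

    moved-nonneg : ∀ {t x} → 0# ≤ t → 0# ≤ x v → 0# ≤ moved t x
    moved-nonneg {t} {x} 0≤t 0≤xv = ≤⇒0≤ (⁺-≤ (0≤⇒≤ (solve 2 (λ x t → x :- (x :- t) := t) refl (x v) t) 0≤t) 0≤xv)

    unmoved : ∀ {t x} → moved t x ≈ 0# → transfer t x ≋ x
    unmoved {t} {x} w≈0 i = begin
      x i + (single a (moved t x) i - single v (moved t x) i)
        ≈⟨ +-congˡ (+-cong (single-0 a w≈0 i) (-‿cong (single-0 v w≈0 i))) ⟩
      x i + (0# - 0#)
        ≈⟨ solve 1 (λ x → x :+ (con (+ 0) :- con (+ 0)) := x) refl (x i) ⟩
      x i ∎

    transfer-0 : ∀ {t x} → t ≈ 0# → 0# ≤ x v → transfer t x ≋ x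
    transfer-0 {t} {x} t≈0 0≤xv = unmoved (begin
      x v - (x v - t) ⁺    ≈⟨ +-congˡ (-‿cong (⁺-pos (≤-respʳ (sym xv-t≈xv) 0≤xv))) ⟩
      x v - (x v - t)      ≈⟨ solve 2 (λ x t → x :- (x :- t) := t) refl (x v) t ⟩
      t                    ≈⟨ t≈0 ⟩
      0#                   ∎)
      where
      xv-t≈xv : x v - t ≈ x v
      xv-t≈xv = trans (+-congˡ (-‿cong t≈0)) (solve 1 (λ x → x :- con (+ 0) := x) refl (x v))

    transfer-absent : ∀ {t x} → 0# ≤ t → x v ≈ 0# → transfer t x ≋ x
    transfer-absent {t} {x} 0≤t xv≈0 = unmoved (begin
      x v - (x v - t) ⁺    ≈⟨ +-cong xv≈0 (-‿cong (⁺-neg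
        (0≤⇒≤ (trans (+-congˡ (-‿cong (+-congʳ xv≈0))) (solve 1 (λ t → con (+ 0) :- (con (+ 0) :- t) := t) refl t)) 0≤t))) ⟩
      0# - 0#              ≈⟨ -‿inverseʳ 0# ⟩
      0#                   ∎)

    module _ (v≢a : v ≢ a) where

      transfer-v : ∀ t x → transfer t x v ≈ (x v - t) ⁺
      transfer-v t x = begin
        x v + (single a w v - single v w v)
          ≈⟨ +-congˡ (+-cong (single-other a v w v≢a) (-‿cong (single-self v w))) ⟩
        x v + (0# - (x v - (x v - t) ⁺))
          ≈⟨ solve 2 (λ x y → x :+ (con (+ 0) :- (x :- y)) := y) refl (x v) ((x v - t) ⁺) ⟩
        (x v - t) ⁺ ∎
        where w = moved t x

      transfer-nonneg : ∀ {t x} → 0# ≤ t → (∀ i → 0# ≤ x i) → ∀ i → 0# ≤ transfer t x i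
      transfer-nonneg {t} {x} 0≤t 0≤x i = cases (i Fin.≟ v)
        where
        w = moved t x

        cases : Dec (i ≡ v) → 0# ≤ transfer t x i
        cases (yes ≡.refl) = ≤-respʳ (sym (transfer-v t x)) (⁺-nonneg _)
        cases (no i≢v)     = ≤-respʳ (+-congˡ (begin
          single a w i                   ≈⟨ solve 1 (λ s → s := s :- con (+ 0)) refl _ ⟩
          single a w i - 0#              ≈⟨ +-congˡ (-‿cong (single-other v i w i≢v)) ⟨
          single a w i - single v w i    ∎))
          (+-nonneg (0≤x i) (single-≤ a (moved-nonneg {x = x} 0≤t (0≤x v)) i))

      transfer-support : ∀ {t x σ} → (∀ i → i Sub.∉ σ → x i ≈ 0#) → v Sub.∈ σ →
                         ∀ i → i Sub.∉ σ Sub.∪ ⁅ a ⁆ → transfer t x i ≈ 0#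
      transfer-support {t} {x} {σ} support v∈σ i i∉ = begin
        x i + (single a w i - single v w i)
          ≈⟨ +-cong (support i (i∉ ∘ Sub.p⊆p∪q _)) (+-cong
               (single-other a i w (λ { ≡.refl → i∉ (Sub.q⊆p∪q σ _ (x∈⁅x⁆ a)) }))
               (-‿cong (single-other v i w (λ { ≡.refl → i∉ (Sub.p⊆p∪q _ v∈σ) })))) ⟩
        0# + (0# - 0#)
          ≈⟨ solve 0 (con (+ 0) :+ (con (+ 0) :- con (+ 0)) := con (+ 0)) refl ⟩
        0# ∎
        where w = moved t x

  realization-resp : ∀ {n} {K : Complex n} {x y} → x ≋ y → ∣_∣ ℝ K x → ∣_∣ ℝ K y
  realization-resp x≋y (0≤x , Σx≈1 , σ , σ∈K , support) =
    (λ i → ≤-respʳ (x≋y i) (0≤x i)) , trans (sum-cong-≋ (λ i → sym (x≋y i))) Σx≈1 ,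
    σ , σ∈K , λ i i∉σ → trans (sym (x≋y i)) (support i i∉σ)

  realization-mono : ∀ {n} {K L : Complex n} {x} → (∀ {σ} → K σ → L σ) → ∣_∣ ℝ K x → ∣_∣ ℝ L x
  realization-mono K⊆L (0≤x , Σx≈1 , σ , σ∈K , support) = 0≤x , Σx≈1 , σ , K⊆L σ∈K , support

  -- The homotopy is defined on a whole Euclidean space, with time as coordinate `zero`, so that
  -- continuity is handled without proofs of membership in the realization. `initial` asks only for
  -- nonnegative coordinates because, during the first half of a composite homotopy, it is applied
  -- to points outside the smaller complex.
  record Contraction {n} (K : Complex n) : Set where
    field
      homotopy   : Point ℝ (suc n) → Point ℝ n
      continuous : Continuous* homotopy
      initial      : ∀ p → p zero ≈ 0# → (∀ i → 0# ≤ p (suc i)) → homotopy p ≋ (p ∘ suc)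
      preserves  : ∀ p → 0# ≤ p zero → p zero ≤ 1# → ∣_∣ ℝ K (p ∘ suc) → ∣_∣ ℝ K (homotopy p)
      centre     : ∃ (∣_∣ ℝ K)
      final        : ∀ p → p zero ≈ 1# → ∣_∣ ℝ K (p ∘ suc) → homotopy p ≋ proj₁ centre

  contraction-point : ∀ {n} {K : Complex n} a → K ⁅ a ⁆ → (∀ σ → K σ → σ Sub.⊆ ⁅ a ⁆) → Contraction K
  contraction-point {K = K} a a∈K K⊆a = record
    { homotopy   = λ p i → p (suc i)
    ; continuous = λ i → cont-proj (suc i)
    ; initial      = λ _ _ _ _ → refl
    ; preserves  = λ _ _ _ x∈K → x∈K
    ; centre     = single a 1# , single-≤ a (inj₁ 0<1) , sum-single a 1# , ⁅ a ⁆ , a∈K ,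
                   λ i i∉a → single-other a i 1# (λ { ≡.refl → i∉a (x∈⁅x⁆ a) })
    ; final        = λ p _ → concentrated
    }
    where
    concentrated : ∀ {x} → ∣_∣ ℝ K x → x ≋ single a 1#
    concentrated {x} (0≤x , Σx≈1 , σ , σ∈K , support) i = trans (spread i) (single-cong xa≈1)
      where
      spread : x ≋ single a (x a)
      spread j with j Fin.≟ a
      ... | yes ≡.refl = refl
      ... | no j≢a     = support j (λ j∈σ → j≢a (x∈⁅y⁆⇒x≡y a (K⊆a σ σ∈K j∈σ)))

      xa≈1 : x a ≈ 1#
      xa≈1 = begin
        x a                  ≈⟨ sum-single a (x a) ⟨
        sum (single a (x a)) ≈⟨ sum-cong-≋ spread ⟨
        sum x                ≈⟨ Σx≈1 ⟩
        1#                   ∎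

      single-cong : ∀ {w w′} → w ≈ w′ → single a w i ≈ single a w′ i
      single-cong w≈w′ with does (i Fin.≟ a)
      ... | true  = w≈w′
      ... | false = refl

  module _ {n : ℕ} {K : Complex n} {a v : Fin n} (dominated : Dominates K a v) (C : Contraction (deletion K v)) where

    private
      module C = Contraction C
      open Transfer v a

      v≢a : v ≢ a
      v≢a = proj₁ dominated

      2t : Point ℝ (suc n) → Carrier
      2t p = p zero + p zero

      -- A concatenation of homotopies in one formula, with no gluing of two halves. Up to time 1/2
      -- the inner time is 0 and mass moves; from then on `2t` is at least 1, all mass has left `v`,
      -- and the inner homotopy runs.
      stage : Point ℝ (suc n) → Point ℝ (suc n)
      stage p = ((2t p - 1#) ⁺) Functional.∷ transfer (2t p) (p ∘ suc)

      cont-2t : Continuous 2t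
      cont-2t = cont-+ (cont-proj zero) (cont-proj zero)

      cont-stage : Continuous* stage
      cont-stage zero    = cont-⁺ (cont-+ cont-2t (cont-const (- 1#)))
      cont-stage (suc i) = cont-transfer cont-2t (cont-proj ∘ suc) i

      vacates : ∀ {s x} → 1# ≤ s → ∣_∣ ℝ K x → ∣_∣ ℝ (deletion K v) (transfer s x)
      vacates {s} {x} 1≤s (0≤x , Σx≈1 , σ , σ∈K , support) with v ∈? σ
      ... | no v∉σ = realization-resp (λ i → sym (transfer-absent {s} {x} 0≤s (support v v∉σ) i))
        (0≤x , Σx≈1 , σ , (σ∈K , v∉σ) , support)
        where
        0≤s : 0# ≤ s
        0≤s = ≤-trans (inj₁ 0<1) 1≤s
      ... | yes v∈σ = transfer-nonneg v≢a 0≤s 0≤x , trans (sum-transfer s x) Σx≈1 ,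
        (σ Sub.∪ ⁅ a ⁆) Sub.- v , (proj₂ (proj₂ dominated σ σ∈K v∈σ) , x∉p-x _ v) , support′
        where
        0≤s : 0# ≤ s
        0≤s = ≤-trans (inj₁ 0<1) 1≤s

        support′ : ∀ i → i Sub.∉ (σ Sub.∪ ⁅ a ⁆) Sub.- v → transfer s x i ≈ 0#
        support′ i i∉ = cases (i Fin.≟ v)
          where
          cases : Dec (i ≡ v) → transfer s x i ≈ 0#
          -- No coordinate exceeds the total mass 1, which is at most `s`, so nothing remains at
          -- `v`.
          cases (yes ≡.refl) = trans (transfer-v v≢a s x) (⁺-neg (0≤⇒≤
            (solve 2 (λ x s → con (+ 0) :- (x :- s) := s :- x) refl (x v) s)
            (≤⇒0≤ (≤-trans (term≤sum 0≤x v) (≤-trans (inj₂ Σx≈1) 1≤s)))))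
          cases (no i≢v) = transfer-support v≢a support v∈σ i (λ i∈ → i∉ (Sub.x∈p∧x≢y⇒x∈p-y i∈ i≢v))

      stays : ∀ {s x} → 0# ≤ s → ∣_∣ ℝ K x → ∣_∣ ℝ K (transfer s x)
      stays {s} {x} 0≤s x∈@(0≤x , Σx≈1 , σ , σ∈K , support) with v ∈? σ
      ... | no v∉σ  = realization-resp (λ i → sym (transfer-absent {s} {x} 0≤s (support v v∉σ) i)) x∈
      ... | yes v∈σ = transfer-nonneg v≢a 0≤s 0≤x , trans (sum-transfer s x) Σx≈1 ,
        σ Sub.∪ ⁅ a ⁆ , proj₁ (proj₂ dominated σ σ∈K v∈σ) , transfer-support v≢a support v∈σ

      early : ∀ p → 2t p ≤ 1# → stage p zero ≈ 0#
      early p 2t≤1 = ⁺-neg (0≤⇒≤ (solve 1 (λ s → con (+ 0) :- (s :- con (+ 1)) := con (+ 1) :- s) refl (2t p)) (≤⇒0≤ 2t≤1))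

      initial : ∀ p → p zero ≈ 0# → (∀ i → 0# ≤ p (suc i)) → C.homotopy (stage p) ≋ (p ∘ suc)
      initial p t≈0 0≤x i = trans
        (C.initial (stage p) (early p (≤-trans (inj₂ 2t≈0) (inj₁ 0<1))) (λ j → ≤-respʳ (sym (T≋x j)) (0≤x j)) i) (T≋x i)
        where
        2t≈0 : 2t p ≈ 0#
        2t≈0 = trans (+-cong t≈0 t≈0) (+-identityʳ 0#)

        T≋x : transfer (2t p) (p ∘ suc) ≋ (p ∘ suc)
        T≋x = transfer-0 2t≈0 (0≤x v)

      preserves : ∀ p → 0# ≤ p zero → p zero ≤ 1# → ∣_∣ ℝ K (p ∘ suc) → ∣_∣ ℝ K (C.homotopy (stage p))
      preserves p 0≤t t≤1 x∈K with 2t p <? 1#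
      ... | yes 2t<1 =
        -- The transferred point may still have mass at `v`; at inner time 0 the homotopy fixes it
        -- nevertheless, as its coordinates are nonnegative.
        let Tx∈K = stays (+-nonneg 0≤t 0≤t) x∈K
        in realization-resp (λ i → sym (C.initial (stage p) (early p (inj₁ 2t<1)) (proj₁ Tx∈K) i)) Tx∈K
      ... | no 2t≮1 = realization-mono proj₁ (C.preserves (stage p) (⁺-nonneg _) (⁺-≤ 2t-1≤1 (inj₁ 0<1)) (vacates (≮⇒≥ 2t≮1) x∈K))
        where
        2t-1≤1 : 2t p - 1# ≤ 1#
        2t-1≤1 = 0≤⇒≤ (solve 1 (λ t → con (+ 1) :- ((t :+ t) :- con (+ 1)) := (con (+ 1) :- t) :+ (con (+ 1) :- t)) refl (p zero))
          (+-nonneg (≤⇒0≤ t≤1) (≤⇒0≤ t≤1))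

      final : ∀ p → p zero ≈ 1# → ∣_∣ ℝ K (p ∘ suc) → C.homotopy (stage p) ≋ proj₁ C.centre
      final p t≈1 x∈K = C.final (stage p) (trans (⁺-pos (≤-respʳ (sym 2t-1≈1) (inj₁ 0<1))) 2t-1≈1)
        (vacates (0≤⇒≤ 2t-1≈1 (inj₁ 0<1)) x∈K)
        where
        2t-1≈1 : 2t p - 1# ≈ 1#
        2t-1≈1 = trans (+-congʳ (+-cong t≈1 t≈1)) (solve 0 ((con (+ 1) :+ con (+ 1)) :- con (+ 1) := con (+ 1)) refl)

    contraction-deletion : Contraction K
    contraction-deletion = record
      { homotopy   = C.homotopy ∘ stage
      ; continuous = λ i → cont-∘ (C.continuous i) cont-stage
      ; initial      = initial
      ; preserves  = preserves
      ; centre     = proj₁ C.centre , realization-mono proj₁ (proj₂ C.centre)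
      ; final        = final
      }

  strongCollapse⇒contraction : ∀ {n} ps (r : Fin n) {K} → StrongCollapse ps r K → Contraction K
  strongCollapse⇒contraction []       r (r∈K , K⊆r)       = contraction-point r r∈K K⊆r
  strongCollapse⇒contraction (_ ∷ ps) r (dominated , rest) =
    contraction-deletion dominated (strongCollapse⇒contraction ps r rest)

  contraction⇒contractible : ∀ {n} {K : Complex n} → Contraction K → Contractible ℝ (∣_∣ ℝ K)
  contraction⇒contractible C =
    (λ (t , 0≤t , t≤1) (x , x∈K) → homotopy (t Functional.∷ x) , preserves (t Functional.∷ x) 0≤t t≤1 x∈K) ,
    (λ (t , _) (x , _) ε 0<ε →
      let δ , 0<δ , c = near-image continuous (t Functional.∷ x) ε 0<ε
      in δ , 0<δ , λ (t′ , _) (x′ , _) t~t′ x~x′ →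
        c (t′ Functional.∷ x′) (λ { zero → t~t′ ; (suc i) → x~x′ i })) ,
    (λ (t , _) (x , 0≤x , _) t≈0 → initial (t Functional.∷ x) t≈0 0≤x) ,
    centre , λ (t , _) (x , x∈K) t≈1 → final (t Functional.∷ x) t≈1 x∈K
    where open Contraction C

  no-obstruction₁ : ¬ ∃ (LocalObstruction₁ ℝ C₀)
  no-obstruction₁ (σ , (σ∈Δ , σ∉C₀) , ¬contractible) =
    let (ps , r) , p , _ = Any.satisfied (link-good σ σ∈Δ σ∉C₀)
    in ¬contractible (contraction⇒contractible (strongCollapse⇒contraction ps r p))

theorem5p7 : (ℝ : CompleteOrderedField) →
    MinimallyNonConvex ℝ C₀ ×
    ¬ ∃ (LocalObstruction₁ ℝ C₀) ×
    ¬ ∃ (LocalObstruction₂ C₀)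
theorem5p7 ℝ =
  (C₀-nonconvex ℝ , trunk-convex ℝ , image-convex ℝ) , no-obstruction₁ ℝ , no-obstruction₂
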